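{- Let $M_1,M_2$ be matroids on the same ground set with $n$ elements, and let $I_k$ denote the number of common independent sets of $M_1$ and $M_2$ of size $k$ (i.e. sets of size $k$ that are independent in both $M_1$ and $M_2$). Then for every integer $k$ with $0\leq k\leq n-2$, $$\frac{I_k}{\binom{n}{k}}\cdot \frac{I_{k+2}}{\binom{n}{k+2}}\leq \left(\frac{I_{k+1}}{\binom{n}{k+1}}\right)^2.$$
   Context: Matroids are finite matroids in the usual sense. -}

module Defs where

open import Data.Bool.Base using (true; false)
open import Data.Fin.Subset using (Subset; inside; outside; ⊥; ⁅_⁆; _∈_; _∉_; _⊆_; _∪_; ∣_∣)
open import Data.Integer.Base using (+_)
open import Data.List.Base using (List; []; _∷_; _++_; map; filter; length)
open import Data.List.Membership.Propositional using () renaming (_∈_ to _∈ˡ_)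
open import Data.List.Membership.Propositional.Properties using (∈-++⁺ˡ; ∈-++⁺ʳ; ∈-map⁺; ∈-map⁻)
open import Data.List.Relation.Binary.Disjoint.Propositional using (Disjoint)
open import Data.List.Relation.Unary.All using ([])
open import Data.List.Relation.Unary.AllPairs using ([]; _∷_)
open import Data.List.Relation.Unary.Any using (here)
open import Data.List.Relation.Unary.Unique.Propositional using (Unique)
open import Data.List.Relation.Unary.Unique.Propositional.Properties using (map⁺; ++⁺)
open import Data.Nat.Base using (ℕ; zero; suc; _∸_; _≤_; _<_; _!; NonZero; >-nonZero)
open import Data.Nat.Combinatorics using (_C_; nCk≡n!/k![n-k]!; [n∸k]!k!∣n!)
open import Data.Nat.Divisibility using (∣⇒≤)
open import Data.Nat.DivMod using (m≥n⇒m/n>0)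
open import Data.Nat.Properties using (_≟_; _!≢0; _!*_!≢0; *-comm)
open import Data.Product.Base using (∃; _×_; _,_)
open import Data.Rational.Base using (ℚ; _/_)
open import Data.Vec.Base using ([]; _∷_)
open import Data.Vec.Properties using (∷-injectiveʳ)
open import Level using (0ℓ)
open import Relation.Binary.PropositionalEquality using (_≡_; refl; sym; subst)
open import Relation.Nullary.Decidable using (_×-dec_)
open import Relation.Unary using (Pred; Decidable)

-- Decidability of independence is automatic classically; it is what makes
-- the independent sets countable here.
record Matroid (n : ℕ) : Set₁ where
  field
    Independent  : Pred (Subset n) 0ℓ
    independent? : Decidable Independent
    empty        : Independent ⊥
    hereditary   : ∀ {p q} → p ⊆ q → Independent q → Independent p
    augmentation : ∀ {p q} → Independent p → Independent q → ∣ p ∣ < ∣ q ∣ →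
                   ∃ λ x → x ∈ q × x ∉ p × Independent (p ∪ ⁅ x ⁆)

subsets : ∀ n → List (Subset n)
subsets zero    = [] ∷ []
subsets (suc n) = map (outside ∷_) (subsets n) ++ map (inside ∷_) (subsets n)

∈-subsets : ∀ {n} (p : Subset n) → p ∈ˡ subsets n
∈-subsets []                 = here refl
∈-subsets (false ∷ p)        = ∈-++⁺ˡ (∈-map⁺ (outside ∷_) (∈-subsets p))
∈-subsets {suc n} (true ∷ p) =
  ∈-++⁺ʳ (map (outside ∷_) (subsets n)) (∈-map⁺ (inside ∷_) (∈-subsets p))

subsets-unique : ∀ n → Unique (subsets n)
subsets-unique zero    = [] ∷ []
subsets-unique (suc n) =
  ++⁺ (map⁺ ∷-injectiveʳ (subsets-unique n)) (map⁺ ∷-injectiveʳ (subsets-unique n))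
      disjoint
  where
  disjoint : Disjoint (map (outside ∷_) (subsets n)) (map (inside ∷_) (subsets n))
  disjoint (p∈out , p∈in) with ∈-map⁻ (outside ∷_) p∈out | ∈-map⁻ (inside ∷_) p∈in
  ... | _ , _ , refl | _ , _ , ()

module _ {n : ℕ} (M₁ M₂ : Matroid n) where
  private
    module M₁ = Matroid M₁
    module M₂ = Matroid M₂

  CommonIndependentOfSize : ℕ → Pred (Subset n) 0ℓ
  CommonIndependentOfSize k p = M₁.Independent p × M₂.Independent p × ∣ p ∣ ≡ k

  commonIndependentOfSize? : ∀ k → Decidable (CommonIndependentOfSize k)
  commonIndependentOfSize? k p =
    M₁.independent? p ×-dec M₂.independent? p ×-dec (∣ p ∣ ≟ k)

  #commonIndependent : ℕ → ℕ
  #commonIndependent k = length (filter (commonIndependentOfSize? k) (subsets n))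

nCk≢0 : ∀ {n k} → k ≤ n → NonZero (n C k)
nCk≢0 {n} {k} k≤n = >-nonZero (subst (0 <_) (sym (nCk≡n!/k![n-k]! k≤n))
  (m≥n⇒m/n>0 (subst (_≤ n !) (*-comm ((n ∸ k) !) (k !)) (∣⇒≤ ([n∸k]!k!∣n! k≤n)))))
  where instance
    _ = n !≢0
    _ = k !* (n ∸ k) !≢0

normalisedCount : ∀ {n} (M₁ M₂ : Matroid n) (k : ℕ) → .(k ≤ n) → ℚ
normalisedCount {n} M₁ M₂ k k≤n =
  _/_ (+ #commonIndependent M₁ M₂ k) (n C k) {{nCk≢0 k≤n}}

{-# OPTIONS --safe #-}
module Submission where

-- For variables x_i, w_i (one pair per ground element) and y, q put
--   F = Σ_A N^r₁(A) x^A y^(n-|A|),   G = Σ_A N^r₂(A) w^(E∖A) q^|A|   (N ≥ 1).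
-- Applying Π_i (∂/∂x_i + ∂/∂w_i) to F·G and setting x = w = 0 leaves
-- Σ_A N^(r₁(A)+r₂(A)) y^(n-|A|) q^|A| up to powers of N.  As N → ∞ the coefficient
-- of y^(n-k) q^k is dominated by the common independent sets A of size k, so it is
-- enough that this binary form is ultra-log-concave, i.e. that its second
-- derivatives are quadratic forms of Lorentzian signature.
--
-- "Lorentzian" means that some positive multiple of the form is at most the square
-- of a linear functional.  If H₁, H₂ are the Hessians of ∂P/∂x and ∂P/∂w, where P has
-- degree at most one in x and in w, then H₁ in the direction w and H₂ in the direction
-- x are the same functional L = ∂²P/∂x∂w.  Eliminating that isotropic direction gives
-- Hᵢ(v,v) ≤ 2 L(v) gᵢ(v), and adding the two bounds shows H₁ + H₂ ≤ (L + g₁ + g₂)².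
-- This needs L ≠ 0, which holds because all the weights N^r are positive (unless one of
-- the two forms is zero for degree reasons, when there is nothing to add).  Before any
-- ∂/∂x_i + ∂/∂w_i has been applied the claim is a statement on each matroid separately,
-- namely Cauchy–Schwarz over the parallel classes of a contraction.

open import Defs

module WeightedForms where

  open import Data.Bool.Base using (Bool; true; false; if_then_else_)
  import Data.Bool.Properties as Boolₚ
  open import Data.Empty using (⊥-elim)
  open import Data.Fin.Base using (Fin; zero; suc)
  import Data.Fin.Properties as Finₚ
  open import Data.Fin.Subset using (Subset; inside; outside; ∁) renaming (∣_∣ to card)
  open import Data.Integer.Base using (ℤ; +_; -[1+_]; -<+; 0ℤ; 1ℤ; _+_; _*_; _-_; -_; _≤_; _<_; +≤+; +<+; positive)
  open import Data.Integer.Properties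
  open import Data.Integer.Tactic.RingSolver using (solve-∀)
  open import Data.List.Base as List using (List; []; _∷_; length)
  import Data.List.Properties as Listₚ
  open import Data.List.Relation.Unary.All as All using (All; []; _∷_)
  import Data.List.Relation.Unary.All.Properties as Allₚ
  open import Data.List.Relation.Unary.AllPairs as AllPairs using (AllPairs; []; _∷_)
  import Data.List.Relation.Unary.AllPairs.Properties as AllPairsₚ
  open import Data.Nat.Base as ℕ using (ℕ; zero; suc; _!)
  import Data.Nat.Properties as ℕₚ
  import Data.Nat.Tactic.RingSolver as ℕ-Solver
  open import Data.Product.Base using (∃-syntax; _×_; _,_; proj₁; proj₂)
  open import Data.Sum.Base using (_⊎_; inj₁; inj₂)
  open import Data.Vec.Base as Vec using (Vec; []; _∷_; lookup; _[_]≔_)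
  import Data.Vec.Properties as Vecₚ
  open import Function.Base using (_∘_)
  open import Level using (0ℓ)
  open import Relation.Binary.Core using (Rel)
  open import Relation.Binary.Definitions using (Decidable)
  open import Relation.Binary.PropositionalEquality
  open import Relation.Binary.Structures using (IsDecEquivalence)
  open import Relation.Nullary using (Dec; yes; no; ¬_; does)
  open import Relation.Nullary.Decidable using (_×-dec_; _⊎-dec_)

  -- Hessians and their Lorentzian signature

  sq : ℤ → ℤ
  sq x = x * x

  0≤sq : ∀ x → 0ℤ ≤ sq x
  0≤sq (+ x) = subst (0ℤ ≤_) (pos-* x x) (+≤+ ℕ.z≤n)
  0≤sq (-[1+ x ]) = +≤+ ℕ.z≤n

  0≤* : ∀ {x y} → 0ℤ ≤ x → 0ℤ ≤ y → 0ℤ ≤ x * y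
  0≤* {+ x} {+ y} _ _ = subst (0ℤ ≤_) (pos-* x y) (+≤+ ℕ.z≤n)

  0≤+ : ∀ {x y} → 0ℤ ≤ x → 0ℤ ≤ y → 0ℤ ≤ x + y
  0≤+ p q = +-mono-≤ p q

  0<* : ∀ {x y} → 0ℤ < x → 0ℤ < y → 0ℤ < x * y
  0<* {+ suc x} {+ suc y} (+<+ _) (+<+ _) = +<+ ℕ.z<s

  0<⇒1≤ : ∀ {x} → 0ℤ < x → 0ℤ ≤ x - 1ℤ
  0<⇒1≤ {+ suc x} (+<+ _) = +≤+ ℕ.z≤n

  by-difference : ∀ {x y d} → 0ℤ ≤ d → d ≡ y - x → x ≤ y
  by-difference p refl = 0≤i-j⇒j≤i p

  difference : ∀ {x y} → x ≤ y → 0ℤ ≤ y - x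
  difference = i≤j⇒0≤j-i

  -- Which of ∂/∂x_i and ∂/∂w_i has been applied for the element i: only the first (S), only
  -- the second (T), or both (B). The remaining variable of an element in state S or T is the one
  -- Hessians are taken in, so a further derivative at i moves it to B.
  data State : Set where
    S T B : State

  -- f σ a b is the derivative recorded by σ, together with ∂^a/∂y^a ∂^b/∂q^b, at the origin.
  Derivatives : ℕ → Set
  Derivatives m = Vec State m → ℕ → ℕ → ℤ

  lin : ∀ {m} → (Vec State m → ℤ) → Vec State m → Vec ℤ m → ℤ
  lin g []      []       = 0ℤ
  lin g (t ∷ σ) (u ∷ us) = u * g (B ∷ σ) + lin (λ τ → g (t ∷ τ)) σ us

  quad : ∀ {m} → (Vec State m → ℤ) → Vec State m → Vec ℤ m → ℤ
  quad g []      []       = 0ℤ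
  quad g (t ∷ σ) (u ∷ us) =
    (u + u) * lin (λ τ → g (B ∷ τ)) σ us + quad (λ τ → g (t ∷ τ)) σ us

  grad : ∀ {m} → Derivatives m → Vec State m → ℕ → ℕ → Vec ℤ m → ℤ → ℤ → ℤ
  grad f σ a b us y q =
    lin (λ τ → f τ a b) σ us + (y * f σ (suc a) b + q * f σ a (suc b))

  hess : ∀ {m} → Derivatives m → Vec State m → ℕ → ℕ → Vec ℤ m → ℤ → ℤ → ℤ
  hess f σ a b us y q =
    quad (λ τ → f τ a b) σ us
    + ((y + y) * lin (λ τ → f τ (suc a) b) σ us + (q + q) * lin (λ τ → f τ a (suc b)) σ us)
    + (y * y * f σ (suc (suc a)) b + (y + y) * q * f σ (suc a) (suc b) + q * q * f σ a (suc (suc b)))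

  hess-∷ : ∀ {m} (f : Derivatives (suc m)) t σ a b u us y q →
    hess f (t ∷ σ) a b (u ∷ us) y q ≡
    (u + u) * grad (λ τ → f (B ∷ τ)) σ a b us y q + hess (λ τ → f (t ∷ τ)) σ a b us y q
  hess-∷ f t σ a b u us y q = identity u y q _ _ _ _ _ _ _ _ _
    where
    identity : ∀ u y q lB Q yB l1 qB l2 c1 c2 c3 →
      (u + u) * lB + Q + ((y + y) * (u * yB + l1) + (q + q) * (u * qB + l2)) + (y * y * c1 + (y + y) * q * c2 + q * q * c3)
      ≡ (u + u) * (lB + (y * yB + q * qB)) + (Q + ((y + y) * l1 + (q + q) * l2) + (y * y * c1 + (y + y) * q * c2 + q * q * c3))
    identity = solve-∀

  record Functional (m : ℕ) : Set where
    constructor functional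
    field
      coeffs   : Vec ℤ m
      coeffʸ   : ℤ
      coeffᵠ   : ℤ

  dot : ∀ {m} → Vec ℤ m → Vec ℤ m → ℤ
  dot []       []       = 0ℤ
  dot (c ∷ cs) (u ∷ us) = u * c + dot cs us

  ⟦_⟧ : ∀ {m} → Functional m → Vec ℤ m → ℤ → ℤ → ℤ
  ⟦ functional cs d e ⟧ us y q = dot cs us + (y * d + q * e)

  infixl 6 _⊞_
  infixr 7 _⊠_

  _⊞_ : ∀ {m} → Functional m → Functional m → Functional m
  functional cs d e ⊞ functional cs′ d′ e′ = functional (Vec.zipWith _+_ cs cs′) (d + d′) (e + e′)

  _⊠_ : ∀ {m} → ℤ → Functional m → Functional m
  k ⊠ functional cs d e = functional (Vec.map (k *_) cs) (k * d) (k * e)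

  dot-+ : ∀ {m} (cs ds us : Vec ℤ m) → dot (Vec.zipWith _+_ cs ds) us ≡ dot cs us + dot ds us
  dot-+ []       []       []       = refl
  dot-+ (c ∷ cs) (d ∷ ds) (u ∷ us) = trans (cong (λ z → u * (c + d) + z) (dot-+ cs ds us)) (identity u c d (dot cs us) (dot ds us))
    where
    identity : ∀ u c d x y → u * (c + d) + (x + y) ≡ u * c + x + (u * d + y)
    identity = solve-∀

  dot-*ˡ : ∀ {m} k (cs us : Vec ℤ m) → dot (Vec.map (k *_) cs) us ≡ k * dot cs us
  dot-*ˡ k []       []       = sym (*-zeroʳ k)
  dot-*ˡ k (c ∷ cs) (u ∷ us) = trans (cong (λ z → u * (k * c) + z) (dot-*ˡ k cs us)) (identity k u c (dot cs us))
    where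
    identity : ∀ k u c x → u * (k * c) + k * x ≡ k * (u * c + x)
    identity = solve-∀

  dot-*ʳ : ∀ {m} k (cs us : Vec ℤ m) → dot cs (Vec.map (k *_) us) ≡ k * dot cs us
  dot-*ʳ k []       []       = sym (*-zeroʳ k)
  dot-*ʳ k (c ∷ cs) (u ∷ us) = trans (cong (λ z → k * u * c + z) (dot-*ʳ k cs us)) (identity k u c (dot cs us))
    where
    identity : ∀ k u c x → k * u * c + k * x ≡ k * (u * c + x)
    identity = solve-∀

  ⟦⟧-⊞ : ∀ {m} (ℓ ℓ′ : Functional m) us y q → ⟦ ℓ ⊞ ℓ′ ⟧ us y q ≡ ⟦ ℓ ⟧ us y q + ⟦ ℓ′ ⟧ us y q
  ⟦⟧-⊞ (functional cs d e) (functional cs′ d′ e′) us y q =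
    trans (cong (_+ _) (dot-+ cs cs′ us)) (identity (dot cs us) (dot cs′ us) y d d′ q e e′)
    where
    identity : ∀ x x′ y d d′ q e e′ →
      x + x′ + (y * (d + d′) + q * (e + e′)) ≡ x + (y * d + q * e) + (x′ + (y * d′ + q * e′))
    identity = solve-∀

  ⟦⟧-⊠ : ∀ {m} k (ℓ : Functional m) us y q → ⟦ k ⊠ ℓ ⟧ us y q ≡ k * ⟦ ℓ ⟧ us y q
  ⟦⟧-⊠ k (functional cs d e) us y q = trans (cong (_+ _) (dot-*ˡ k cs us)) (identity k _ y d q e)
    where
    identity : ∀ k x y d q e → k * x + (y * (k * d) + q * (k * e)) ≡ k * (x + (y * d + q * e))
    identity = solve-∀

  ⟦⟧-homogeneous : ∀ {m} k (ℓ : Functional m) us y q →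
    ⟦ ℓ ⟧ (Vec.map (k *_) us) (k * y) (k * q) ≡ k * ⟦ ℓ ⟧ us y q
  ⟦⟧-homogeneous k (functional cs d e) us y q = trans (cong (_+ _) (dot-*ʳ k cs us)) (identity k _ y d q e)
    where
    identity : ∀ k x y d q e → k * x + (k * y * d + k * q * e) ≡ k * (x + (y * d + q * e))
    identity = solve-∀

  lin-coeffs : ∀ {m} → (Vec State m → ℤ) → Vec State m → Vec ℤ m
  lin-coeffs g []      = []
  lin-coeffs g (t ∷ σ) = g (B ∷ σ) ∷ lin-coeffs (λ τ → g (t ∷ τ)) σ

  lin≡dot : ∀ {m} (g : Vec State m → ℤ) σ us → lin g σ us ≡ dot (lin-coeffs g σ) us
  lin≡dot g []      []       = refl
  lin≡dot g (t ∷ σ) (u ∷ us) = cong (λ z → u * g (B ∷ σ) + z) (lin≡dot (λ τ → g (t ∷ τ)) σ us)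

  grad-functional : ∀ {m} → Derivatives m → Vec State m → ℕ → ℕ → Functional m
  grad-functional f σ a b = functional (lin-coeffs (λ τ → f τ a b) σ) (f σ (suc a) b) (f σ a (suc b))

  grad≡⟦⟧ : ∀ {m} (f : Derivatives m) σ a b us y q → grad f σ a b us y q ≡ ⟦ grad-functional f σ a b ⟧ us y q
  grad≡⟦⟧ f σ a b us y q = cong (_+ _) (lin≡dot _ σ us)

  lin-homogeneous : ∀ {m} k (g : Vec State m → ℤ) σ us → lin g σ (Vec.map (k *_) us) ≡ k * lin g σ us
  lin-homogeneous k g σ us = begin
    lin g σ (Vec.map (k *_) us)          ≡⟨ lin≡dot g σ _ ⟩
    dot (lin-coeffs g σ) (Vec.map (k *_) us) ≡⟨ dot-*ʳ k (lin-coeffs g σ) us ⟩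
    k * dot (lin-coeffs g σ) us          ≡⟨ cong (k *_) (lin≡dot g σ us) ⟨
    k * lin g σ us                       ∎
    where open ≡-Reasoning

  quad-homogeneous : ∀ {m} k (g : Vec State m → ℤ) σ us → quad g σ (Vec.map (k *_) us) ≡ k * k * quad g σ us
  quad-homogeneous k g []      []       = sym (*-zeroʳ (k * k))
  quad-homogeneous k g (t ∷ σ) (u ∷ us) =
    trans (cong₂ (λ x y → (k * u + k * u) * x + y) (lin-homogeneous k _ σ us) (quad-homogeneous k _ σ us))
          (identity k u _ _)
    where
    identity : ∀ k u x y → (k * u + k * u) * (k * x) + k * k * y ≡ k * k * ((u + u) * x + y)
    identity = solve-∀

  hess-homogeneous : ∀ {m} k (f : Derivatives m) σ a b us y q →
    hess f σ a b (Vec.map (k *_) us) (k * y) (k * q) ≡ k * k * hess f σ a b us y q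
  hess-homogeneous k f σ a b us y q =
    trans (cong₂ _+_ (cong₂ _+_ (quad-homogeneous k _ σ us)
                        (cong₂ (λ x x′ → (k * y + k * y) * x + (k * q + k * q) * x′)
                           (lin-homogeneous k _ σ us) (lin-homogeneous k _ σ us)))
                     refl)
          (identity k y q _ _ _ _ _ _)
    where
    identity : ∀ k y q Q l l′ c₁ c₂ c₃ →
      k * k * Q + ((k * y + k * y) * (k * l) + (k * q + k * q) * (k * l′))
        + (k * y * (k * y) * c₁ + (k * y + k * y) * (k * q) * c₂ + k * q * (k * q) * c₃)
      ≡ k * k * (Q + ((y + y) * l + (q + q) * l′) + (y * y * c₁ + (y + y) * q * c₂ + q * q * c₃))
    identity = solve-∀

  lin-+ : ∀ {m} (g h : Vec State m → ℤ) σ us → lin (λ τ → g τ + h τ) σ us ≡ lin g σ us + lin h σ us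
  lin-+ g h []      []       = refl
  lin-+ g h (t ∷ σ) (u ∷ us) = trans (cong (λ z → u * (g (B ∷ σ) + h (B ∷ σ)) + z) (lin-+ gₜ hₜ σ us))
          (identity u (g (B ∷ σ)) (h (B ∷ σ)) (lin gₜ σ us) (lin hₜ σ us))
    where
    gₜ hₜ : Vec State _ → ℤ
    gₜ τ = g (t ∷ τ)
    hₜ τ = h (t ∷ τ)
    identity : ∀ u c d x y → u * (c + d) + (x + y) ≡ u * c + x + (u * d + y)
    identity = solve-∀

  quad-+ : ∀ {m} (g h : Vec State m → ℤ) σ us → quad (λ τ → g τ + h τ) σ us ≡ quad g σ us + quad h σ us
  quad-+ g h []      []       = refl
  quad-+ g h (t ∷ σ) (u ∷ us) =
    trans (cong₂ (λ x y → (u + u) * x + y) (lin-+ g′ h′ σ us) (quad-+ gₜ hₜ σ us))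
          (identity u (lin g′ σ us) (lin h′ σ us) (quad gₜ σ us) (quad hₜ σ us))
    where
    g′ h′ gₜ hₜ : Vec State _ → ℤ
    g′ τ = g (B ∷ τ)
    h′ τ = h (B ∷ τ)
    gₜ τ = g (t ∷ τ)
    hₜ τ = h (t ∷ τ)
    identity : ∀ u c d x y → (u + u) * (c + d) + (x + y) ≡ (u + u) * c + x + ((u + u) * d + y)
    identity = solve-∀

  hess-+ : ∀ {m} (f g : Derivatives m) σ a b us y q →
    hess (λ τ a b → f τ a b + g τ a b) σ a b us y q ≡ hess f σ a b us y q + hess g σ a b us y q
  hess-+ f g σ a b us y q =
    trans (cong₂ _+_ (cong₂ _+_ (quad-+ (f· a b) (g· a b) σ us)
                        (cong₂ (λ x x′ → (y + y) * x + (q + q) * x′)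
                          (lin-+ (f· (suc a) b) (g· (suc a) b) σ us) (lin-+ (f· a (suc b)) (g· a (suc b)) σ us)))
                     refl)
          (identity y q (quad (f· a b) σ us) (quad (g· a b) σ us)
            (lin (f· (suc a) b) σ us) (lin (g· (suc a) b) σ us) (lin (f· a (suc b)) σ us) (lin (g· a (suc b)) σ us)
            (f σ (suc (suc a)) b) (g σ (suc (suc a)) b) (f σ (suc a) (suc b)) (g σ (suc a) (suc b))
            (f σ a (suc (suc b))) (g σ a (suc (suc b))))
    where
    f· g· : ℕ → ℕ → Vec State _ → ℤ
    f· a b τ = f τ a b
    g· a b τ = g τ a b
    identity : ∀ y q Q Q′ l l′ r r′ c₁ c₁′ c₂ c₂′ c₃ c₃′ →
      Q + Q′ + ((y + y) * (l + l′) + (q + q) * (r + r′))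
        + (y * y * (c₁ + c₁′) + (y + y) * q * (c₂ + c₂′) + q * q * (c₃ + c₃′))
      ≡ Q + ((y + y) * l + (q + q) * r) + (y * y * c₁ + (y + y) * q * c₂ + q * q * c₃)
        + (Q′ + ((y + y) * l′ + (q + q) * r′) + (y * y * c₁′ + (y + y) * q * c₂′ + q * q * c₃′))
    identity = solve-∀

  Lorentzian : ∀ {m} → Derivatives m → Vec State m → ℕ → ℕ → Set
  Lorentzian {m} f σ a b = ∃[ c ] 0ℤ < c × ∃[ ℓ ]
    (∀ us y q → c * hess f σ a b us y q ≤ sq (⟦_⟧ {m} ℓ us y q))

  merge : ∀ {m} → Derivatives (suc m) → Derivatives m
  merge f σ a b = f (S ∷ σ) a b + f (T ∷ σ) a b

  -- If the coefficient p of u in the functional were 0, the bound would fail for large u.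
  pivot≢0 : ∀ {c l p h r : ℤ} → 0ℤ < c → 0ℤ < l →
    (∀ u → c * ((u + u) * l + h) ≤ sq (u * p + r)) → ¬ p ≡ 0ℤ
  pivot≢0 {c} {l} {_} {h} {r} 0<c 0<l bound refl = <⇒≱ -<+ (≤-trans 0≤sum (≤-reflexive (identity c l h r)))
    where
    u x : ℤ
    u = sq r + sq (c * h) + 1ℤ
    x = c * h
    0≤u : 0ℤ ≤ u
    0≤u = 0≤+ (0≤+ (0≤sq r) (0≤sq x)) (+≤+ ℕ.z≤n)
    identity : ∀ c l h r → 
      (((r * r + c * h * (c * h) + 1ℤ) * 0ℤ + r) * ((r * r + c * h * (c * h) + 1ℤ) * 0ℤ + r) - c * (((r * r + c * h * (c * h) + 1ℤ) + (r * r + c * h * (c * h) + 1ℤ)) * l + h)) + (((r * r + c * h * (c * h) + 1ℤ) * 0ℤ + r) * ((r * r + c * h * (c * h) + 1ℤ) * 0ℤ + r) - c * (((r * r + c * h * (c * h) + 1ℤ) + (r * r + c * h * (c * h) + 1ℤ)) * l + h))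
      + (((r * r + c * h * (c * h) + 1ℤ) + (r * r + c * h * (c * h) + 1ℤ) + ((r * r + c * h * (c * h) + 1ℤ) + (r * r + c * h * (c * h) + 1ℤ))) * (c * l - 1ℤ) + (r * r + r * r + ((c * h) * (c * h) + (c * h) * (c * h)) + (((c * h) + 1ℤ) * ((c * h) + 1ℤ) + (c * h) * (c * h) + 1ℤ)))
      ≡ - (1ℤ + 1ℤ)
    identity = solve-∀
    0≤gap : 0ℤ ≤ sq (u * 0ℤ + r) - c * ((u + u) * l + h)
    0≤gap = difference (bound u)
    0≤sum : 0ℤ ≤ (sq (u * 0ℤ + r) - c * ((u + u) * l + h)) + (sq (u * 0ℤ + r) - c * ((u + u) * l + h))
      + ((u + u + (u + u)) * (c * l - 1ℤ) + (sq r + sq r + (sq x + sq x) + (sq (x + 1ℤ) + sq x + 1ℤ)))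
    0≤sum = 0≤+ (0≤+ 0≤gap 0≤gap)
      (0≤+ (0≤* (0≤+ (0≤+ 0≤u 0≤u) (0≤+ 0≤u 0≤u)) (0<⇒1≤ (0<* 0<c 0<l)))
           (0≤+ (0≤+ (0≤+ (0≤sq r) (0≤sq r)) (0≤+ (0≤sq x) (0≤sq x)))
                (0≤+ (0≤+ (0≤sq (x + 1ℤ)) (0≤sq x)) (+≤+ ℕ.z≤n))))

  cancel-pos : ∀ {c x y} → 0ℤ < c → c * x ≤ c * y → x ≤ y
  cancel-pos {c} {x} {y} 0<c = *-cancelˡ-≤-pos x y c {{positive 0<c}}

  0<sq : ∀ {x} → ¬ x ≡ 0ℤ → 0ℤ < sq x
  0<sq {+ zero}      x≢0 = ⊥-elim (x≢0 refl)
  0<sq {+ suc x}     _   = +<+ ℕ.z<s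
  0<sq { -[1+ x ]}  _   = +<+ ℕ.z<s

  -- Substitute u = -r and scale the other coordinates by p, which makes the functional vanish.
  eliminate : ∀ {m} (f : Derivatives (suc m)) t σ a b {c p cs d e} → 0ℤ < c →
    (∀ us y q → c * hess f (t ∷ σ) a b us y q ≤ sq (⟦ functional (p ∷ cs) d e ⟧ us y q)) →
    ∀ us y q → let L = grad (λ τ → f (B ∷ τ)) σ a b us y q ; r = ⟦ functional cs d e ⟧ us y q in
    sq p * hess (λ τ → f (t ∷ τ)) σ a b us y q ≤ r * p * L + r * p * L
  eliminate f t σ a b {c} {p} {cs} {d} {e} 0<c bound us y q =
    cancel-pos 0<c (by-difference (difference (bound (- r ∷ Vec.map (p *_) us) (p * y) (p * q)))
      (sym (trans (identity c p r H L)
        (cong₂ (λ x h → x - c * h)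
          (cong sq (trans (cong (λ x → - r * p + x) (sym (⟦⟧-homogeneous p ℓ us y q))) (sym (+-assoc (- r * p) _ _))))
          (trans (cong₂ (λ x h → (- r + - r) * x + h)
                    (trans (cong (p *_) (grad≡⟦⟧ fB σ a b us y q))
                      (trans (sym (⟦⟧-homogeneous p (grad-functional fB σ a b) us y q))
                             (sym (grad≡⟦⟧ fB σ a b (Vec.map (p *_) us) (p * y) (p * q)))))
                    (sym (hess-homogeneous p (λ τ → f (t ∷ τ)) σ a b us y q)))
                 (sym (hess-∷ f t σ a b (- r) (Vec.map (p *_) us) (p * y) (p * q))))))))
    where
    fB : Derivatives _
    fB τ = f (B ∷ τ)
    ℓ : Functional _
    ℓ = functional cs d e
    r L H : ℤ
    r = ⟦ ℓ ⟧ us y q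
    L = grad fB σ a b us y q
    H = hess (λ τ → f (t ∷ τ)) σ a b us y q
    identity : ∀ c p r H L →
      c * (r * p * L + r * p * L) - c * (p * p * H) ≡
      (- r * p + p * r) * (- r * p + p * r) - c * ((- r + - r) * (p * L) + p * p * H)
    identity = solve-∀

  pivot-nonzero : ∀ {m} (f : Derivatives (suc m)) t σ a b {c p cs d e} → 0ℤ < c →
    (∀ us y q → c * hess f (t ∷ σ) a b us y q ≤ sq (⟦ functional (p ∷ cs) d e ⟧ us y q)) →
    (∃[ us ] ∃[ y ] ∃[ q ] 0ℤ < grad (λ τ → f (B ∷ τ)) σ a b us y q) → ¬ p ≡ 0ℤ
  pivot-nonzero f t σ a b {c} {p} {cs} {d} {e} 0<c bound (us , y , q , 0<L) =
    pivot≢0 {h = hess (λ τ → f (t ∷ τ)) σ a b us y q} 0<c 0<L λ u →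
      subst₂ _≤_ (cong (c *_) (hess-∷ f t σ a b u us y q)) (cong sq (+-assoc (u * p) _ _)) (bound (u ∷ us) y q)

  merge-lorentzian : ∀ {m} (f : Derivatives (suc m)) σ a b →
    (∃[ us ] ∃[ y ] ∃[ q ] 0ℤ < grad (λ τ → f (B ∷ τ)) σ a b us y q) →
    Lorentzian f (S ∷ σ) a b → Lorentzian f (T ∷ σ) a b → Lorentzian (merge f) σ a b
  merge-lorentzian f σ a b L≢0 (c , 0<c , functional (p ∷ cs) d e , bound) (c′ , 0<c′ , functional (p′ ∷ cs′) d′ e′ , bound′) =
    sq p * sq p′ , 0<* (0<sq p≢0) (0<sq p′≢0) ,
    grad-functional fB σ a b ⊞ ((sq p′ * p) ⊠ ℓ ⊞ (sq p * p′) ⊠ ℓ′) , combined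
    where
    fB : Derivatives _
    fB τ = f (B ∷ τ)
    ℓ ℓ′ : Functional _
    ℓ = functional cs d e
    ℓ′ = functional cs′ d′ e′
    p≢0 : ¬ p ≡ 0ℤ
    p≢0 = pivot-nonzero f S σ a b {c} {p} {cs} {d} {e} 0<c bound L≢0
    p′≢0 : ¬ p′ ≡ 0ℤ
    p′≢0 = pivot-nonzero f T σ a b {c′} {p′} {cs′} {d′} {e′} 0<c′ bound′ L≢0
    identity : ∀ p p′ r r′ H H′ L →
      p′ * p′ * ((r * p * L + r * p * L) - p * p * H) + p * p * ((r′ * p′ * L + r′ * p′ * L) - p′ * p′ * H′)
        + (L * L + (p′ * p′ * p * r + p * p * p′ * r′) * (p′ * p′ * p * r + p * p * p′ * r′))
      ≡ (L + (p′ * p′ * p * r + p * p * p′ * r′)) * (L + (p′ * p′ * p * r + p * p * p′ * r′)) - p * p * (p′ * p′) * (H + H′)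
    identity = solve-∀
    combined : ∀ us y q → sq p * sq p′ * hess (merge f) σ a b us y q ≤
      sq (⟦ grad-functional fB σ a b ⊞ ((sq p′ * p) ⊠ ℓ ⊞ (sq p * p′) ⊠ ℓ′) ⟧ us y q)
    combined us y q = by-difference
      (0≤+ (0≤+ (0≤* (0≤sq p′) (difference (eliminate f S σ a b {c} {p} {cs} {d} {e} 0<c bound us y q)))
                (0≤* (0≤sq p) (difference (eliminate f T σ a b {c′} {p′} {cs′} {d′} {e′} 0<c′ bound′ us y q))))
           (0≤+ (0≤sq (grad fB σ a b us y q)) (0≤sq (sq p′ * p * ⟦ ℓ ⟧ us y q + sq p * p′ * ⟦ ℓ′ ⟧ us y q))))
      (trans (identity p p′ _ _ (hess (λ τ → f (S ∷ τ)) σ a b us y q) (hess (λ τ → f (T ∷ τ)) σ a b us y q) (grad fB σ a b us y q))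
        (cong₂ (λ x h → sq x - sq p * sq p′ * h)
          (trans (cong₂ _+_ (grad≡⟦⟧ fB σ a b us y q)
                    (trans (cong₂ _+_ (sym (⟦⟧-⊠ (sq p′ * p) ℓ us y q)) (sym (⟦⟧-⊠ (sq p * p′) ℓ′ us y q)))
                           (sym (⟦⟧-⊞ ((sq p′ * p) ⊠ ℓ) ((sq p * p′) ⊠ ℓ′) us y q))))
                 (sym (⟦⟧-⊞ (grad-functional fB σ a b) _ us y q)))
          (sym (hess-+ (λ τ → f (S ∷ τ)) (λ τ → f (T ∷ τ)) σ a b us y q))))

  hess-0∷ : ∀ {m} (f : Derivatives (suc m)) t σ a b us y q →
    hess f (t ∷ σ) a b (0ℤ ∷ us) y q ≡ hess (λ τ → f (t ∷ τ)) σ a b us y q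
  hess-0∷ f t σ a b us y q =
    trans (hess-∷ f t σ a b 0ℤ us y q) (+-identityˡ _)

  restrict : ∀ {m} (f : Derivatives (suc m)) t σ a b → Lorentzian f (t ∷ σ) a b → Lorentzian (λ τ → f (t ∷ τ)) σ a b
  restrict f t σ a b (c , 0<c , functional (p ∷ cs) d e , bound) =
    c , 0<c , functional cs d e , λ us y q →
      subst₂ _≤_ (cong (c *_) (hess-0∷ f t σ a b us y q)) (cong (λ x → sq (x + _)) (+-identityˡ (dot cs us)))
        (bound (0ℤ ∷ us) y q)

  lorentzian-resp : ∀ {m} (f g : Derivatives m) σ a b → (∀ us y q → hess f σ a b us y q ≡ hess g σ a b us y q) →
    Lorentzian f σ a b → Lorentzian g σ a b
  lorentzian-resp f g σ a b f≈g (c , 0<c , ℓ , bound) =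
    c , 0<c , ℓ , λ us y q → subst (λ h → c * h ≤ _) (f≈g us y q) (bound us y q)

  degree : ∀ {m} → (State → ℕ) → Vec State m → ℕ
  degree w []      = 0
  degree w (t ∷ σ) = w t ℕ.+ degree w σ

  weightˣ weightʷ : State → ℕ
  weightˣ S = 1
  weightˣ T = 0
  weightˣ B = 1
  weightʷ S = 0
  weightʷ T = 1
  weightʷ B = 1

  weightˣ≤B : ∀ t → weightˣ t ℕ.≤ weightˣ B
  weightˣ≤B S = ℕₚ.≤-refl
  weightˣ≤B T = ℕ.z≤n
  weightˣ≤B B = ℕₚ.≤-refl

  weightʷ≤B : ∀ t → weightʷ t ℕ.≤ weightʷ B
  weightʷ≤B S = ℕ.z≤n
  weightʷ≤B T = ℕₚ.≤-refl
  weightʷ≤B B = ℕₚ.≤-refl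

  degˣ degʷ : ∀ {m} → Vec State m → ℕ
  degˣ = degree weightˣ
  degʷ = degree weightʷ

  states : ∀ {m} → Subset m → Vec State m
  states []          = []
  states (true  ∷ p) = S ∷ states p
  states (false ∷ p) = T ∷ states p

  degˣ+degʷ : ∀ {m} (p : Subset m) → degˣ (states p) ℕ.+ degʷ (states p) ≡ m
  degˣ+degʷ []          = refl
  degˣ+degʷ (true  ∷ p) = cong suc (degˣ+degʷ p)
  degˣ+degʷ (false ∷ p) = trans (ℕₚ.+-suc _ _) (cong suc (degˣ+degʷ p))

  module _ {w : State → ℕ} (w≤B : ∀ t → w t ℕ.≤ w B) where

    lin-zero : ∀ {m} (g : Vec State m → ℤ) σ → (∀ τ → degree w σ ℕ.≤ degree w τ → g τ ≡ 0ℤ) →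
      ∀ us → lin g σ us ≡ 0ℤ
    lin-zero g []      g≡0 []       = refl
    lin-zero g (t ∷ σ) g≡0 (u ∷ us) = cong₂ _+_
      (trans (cong (u *_) (g≡0 (B ∷ σ) (ℕₚ.+-monoˡ-≤ (degree w σ) (w≤B t)))) (*-zeroʳ u))
      (lin-zero (λ τ → g (t ∷ τ)) σ (λ τ σ≤τ → g≡0 (t ∷ τ) (ℕₚ.+-monoʳ-≤ (w t) σ≤τ)) us)

    quad-zero : ∀ {m} (g : Vec State m → ℤ) σ → (∀ τ → degree w σ ℕ.≤ degree w τ → g τ ≡ 0ℤ) →
      ∀ us → quad g σ us ≡ 0ℤ
    quad-zero g []      g≡0 []       = refl
    quad-zero g (t ∷ σ) g≡0 (u ∷ us) = cong₂ _+_
      (trans (cong ((u + u) *_)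
               (lin-zero (λ τ → g (B ∷ τ)) σ (λ τ σ≤τ → g≡0 (B ∷ τ) (ℕₚ.+-mono-≤ (w≤B t) σ≤τ)) us))
             (*-zeroʳ (u + u)))
      (quad-zero (λ τ → g (t ∷ τ)) σ (λ τ σ≤τ → g≡0 (t ∷ τ) (ℕₚ.+-monoʳ-≤ (w t) σ≤τ)) us)

    hess-zero : ∀ {m} (f : Derivatives m) σ a b →
      (∀ τ a′ b′ → degree w σ ℕ.≤ degree w τ → a ℕ.≤ a′ → b ℕ.≤ b′ → f τ a′ b′ ≡ 0ℤ) →
      ∀ us y q → hess f σ a b us y q ≡ 0ℤ
    hess-zero f σ a b f≡0 us y q
      rewrite quad-zero (λ τ → f τ a b) σ (λ τ σ≤τ → f≡0 τ a b σ≤τ ℕₚ.≤-refl ℕₚ.≤-refl) us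
            | lin-zero (λ τ → f τ (suc a) b) σ (λ τ σ≤τ → f≡0 τ (suc a) b σ≤τ (ℕₚ.n≤1+n a) ℕₚ.≤-refl) us
            | lin-zero (λ τ → f τ a (suc b)) σ (λ τ σ≤τ → f≡0 τ a (suc b) σ≤τ ℕₚ.≤-refl (ℕₚ.n≤1+n b)) us
            | f≡0 σ (suc (suc a)) b ℕₚ.≤-refl (ℕₚ.m≤n+m a 2) ℕₚ.≤-refl
            | f≡0 σ (suc a) (suc b) ℕₚ.≤-refl (ℕₚ.n≤1+n a) (ℕₚ.n≤1+n b)
            | f≡0 σ a (suc (suc b)) ℕₚ.≤-refl ℕₚ.≤-refl (ℕₚ.m≤n+m b 2)
      = identity y q
      where
      identity : ∀ y q → 0ℤ + ((y + y) * 0ℤ + (q + q) * 0ℤ) + (y * y * 0ℤ + (y + y) * q * 0ℤ + q * q * 0ℤ) ≡ 0ℤ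
      identity = solve-∀

  lin-origin : ∀ {m} (g : Vec State m → ℤ) σ → lin g σ (Vec.replicate m 0ℤ) ≡ 0ℤ
  lin-origin g []      = refl
  lin-origin g (t ∷ σ) = cong₂ _+_ (*-zeroˡ (g (B ∷ σ))) (lin-origin (λ τ → g (t ∷ τ)) σ)

  grad-y : ∀ {m} (f : Derivatives m) σ a b → grad f σ a b (Vec.replicate m 0ℤ) 1ℤ 0ℤ ≡ f σ (suc a) b
  grad-y f σ a b = trans (cong (_+ (1ℤ * f σ (suc a) b + 0ℤ * f σ a (suc b))) (lin-origin (λ τ → f τ a b) σ))
    (identity (f σ (suc a) b) (f σ a (suc b)))
    where
    identity : ∀ x x′ → 0ℤ + (1ℤ * x + 0ℤ * x′) ≡ x
    identity = solve-∀

  grad-q : ∀ {m} (f : Derivatives m) σ a b → grad f σ a b (Vec.replicate m 0ℤ) 0ℤ 1ℤ ≡ f σ a (suc b)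
  grad-q f σ a b = trans (cong (_+ (0ℤ * f σ (suc a) b + 1ℤ * f σ a (suc b))) (lin-origin (λ τ → f τ a b) σ))
    (identity (f σ (suc a) b) (f σ a (suc b)))
    where
    identity : ∀ x x′ → 0ℤ + (0ℤ * x + 1ℤ * x′) ≡ x′
    identity = solve-∀

  -- f stands for a polynomial bihomogeneous of total degree 2n to which r operators ∂/∂x_i + ∂/∂w_i
  -- have been applied; pos and zero say that its support is as large as the degrees permit.
  record Good (n r : ℕ) {m : ℕ} (f : Derivatives m) : Set where
    field
      nonneg     : ∀ σ a b → 0ℤ ≤ f σ a b
      pos        : ∀ σ a b → degˣ σ ℕ.+ a ℕ.≤ n → degʷ σ ℕ.+ b ℕ.≤ n →
                   degˣ σ ℕ.+ a ℕ.+ (degʷ σ ℕ.+ b) ℕ.+ r ≡ n ℕ.+ n → 0ℤ < f σ a b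
      zeroˣ      : ∀ σ a b → n ℕ.< degˣ σ ℕ.+ a → f σ a b ≡ 0ℤ
      zeroʷ      : ∀ σ a b → n ℕ.< degʷ σ ℕ.+ b → f σ a b ≡ 0ℤ
      lorentzian : ∀ p a b → 2 ℕ.+ (a ℕ.+ b) ≡ n → Lorentzian f (states p) a b

  merge-good : ∀ {n r m} (f : Derivatives (suc m)) → suc m ℕ.+ r ≡ n → Good n r f → Good n (suc r) (merge f)
  merge-good {n} {r} {m} f size good = record
    { nonneg     = λ σ a b → 0≤+ (nonneg (S ∷ σ) a b) (nonneg (T ∷ σ) a b)
    ; pos        = positivity
    ; zeroˣ      = λ σ a b n< → cong₂ _+_ (zeroˣ (S ∷ σ) a b (ℕₚ.m≤n⇒m≤1+n n<)) (zeroˣ (T ∷ σ) a b n<)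
    ; zeroʷ      = λ σ a b n< → cong₂ _+_ (zeroʷ (S ∷ σ) a b n<) (zeroʷ (T ∷ σ) a b (ℕₚ.m≤n⇒m≤1+n n<))
    ; lorentzian = lor
    }
    where
    open Good good
    positivity : ∀ σ a b → degˣ σ ℕ.+ a ℕ.≤ n → degʷ σ ℕ.+ b ℕ.≤ n →
      degˣ σ ℕ.+ a ℕ.+ (degʷ σ ℕ.+ b) ℕ.+ suc r ≡ n ℕ.+ n → 0ℤ < merge f σ a b
    positivity σ a b x≤n w≤n total with suc (degˣ σ ℕ.+ a) ℕₚ.≤? n
    ... | yes x<n = +-mono-<-≤ (pos (S ∷ σ) a b x<n w≤n (trans (sym (ℕₚ.+-suc _ r)) total)) (nonneg (T ∷ σ) a b)
    ... | no  x≮n = +-mono-≤-< (nonneg (S ∷ σ) a b) (pos (T ∷ σ) a b x≤n w<n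
        (trans (cong (ℕ._+ r) (ℕₚ.+-suc (degˣ σ ℕ.+ a) _)) (trans (sym (ℕₚ.+-suc _ r)) total)))
      where
      x≡n : degˣ σ ℕ.+ a ≡ n
      x≡n = ℕₚ.≤-antisym x≤n (ℕₚ.≮⇒≥ x≮n)
      w+r≡n : degʷ σ ℕ.+ b ℕ.+ suc r ≡ n
      w+r≡n = ℕₚ.+-cancelˡ-≡ n _ _ (trans (sym (ℕₚ.+-assoc n _ (suc r)))
        (subst (λ k → k ℕ.+ (degʷ σ ℕ.+ b) ℕ.+ suc r ≡ n ℕ.+ n) x≡n total))
      w<n : suc (degʷ σ ℕ.+ b) ℕ.≤ n
      w<n = subst (suc (degʷ σ ℕ.+ b) ℕ.≤_) (trans (sym (ℕₚ.+-suc _ r)) w+r≡n) (ℕₚ.m≤m+n _ r)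

    lor : ∀ p a b → 2 ℕ.+ (a ℕ.+ b) ≡ n → Lorentzian (merge f) (states p) a b
    lor p a b ab = cases
      where
      σ : Vec State m
      σ = states p
      x y : ℕ
      x = degˣ σ
      y = degʷ σ
      fₛ fₜ : Derivatives m
      fₛ τ = f (S ∷ τ)
      fₜ τ = f (T ∷ τ)
      lorₛ : Lorentzian f (S ∷ σ) a b
      lorₛ = lorentzian (true ∷ p) a b ab
      lorₜ : Lorentzian f (T ∷ σ) a b
      lorₜ = lorentzian (false ∷ p) a b ab
      total : x ℕ.+ a ℕ.+ (y ℕ.+ b) ℕ.+ (3 ℕ.+ r) ≡ n ℕ.+ n
      total = trans (rearrange x y a b r)
        (cong₂ ℕ._+_ ab (trans (cong (λ k → suc k ℕ.+ r) (degˣ+degʷ p)) size))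
        where
        rearrange : ∀ x y a b r → x ℕ.+ a ℕ.+ (y ℕ.+ b) ℕ.+ (3 ℕ.+ r) ≡ 2 ℕ.+ (a ℕ.+ b) ℕ.+ (suc (x ℕ.+ y) ℕ.+ r)
        rearrange = ℕ-Solver.solve-∀
      cases : Lorentzian (merge f) σ a b
      cases with n ℕₚ.≤? x ℕ.+ a | n ℕₚ.≤? y ℕ.+ b | suc (suc (x ℕ.+ a)) ℕₚ.≤? n | suc (suc (y ℕ.+ b)) ℕₚ.≤? n
      ... | yes n≤x | _ | _ | _ = lorentzian-resp fₜ (merge f) σ a b
        (λ us y q → sym (trans (hess-+ fₛ fₜ σ a b us y q) (trans (cong (_+ hess fₜ σ a b us y q)
           (hess-zero weightˣ≤B fₛ σ a b (λ τ a′ b′ σ≤τ a≤a′ b≤b′ →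
              zeroˣ (S ∷ τ) a′ b′ (ℕ.s≤s (ℕₚ.≤-trans n≤x (ℕₚ.+-mono-≤ σ≤τ a≤a′)))) us y q)) (+-identityˡ _))))
        (restrict f T σ a b lorₜ)
      ... | no _ | yes n≤y | _ | _ = lorentzian-resp fₛ (merge f) σ a b
        (λ us y q → sym (trans (hess-+ fₛ fₜ σ a b us y q) (trans (cong (λ h → hess fₛ σ a b us y q + h)
           (hess-zero weightʷ≤B fₜ σ a b (λ τ a′ b′ σ≤τ a≤a′ b≤b′ →
              zeroʷ (T ∷ τ) a′ b′ (ℕ.s≤s (ℕₚ.≤-trans n≤y (ℕₚ.+-mono-≤ σ≤τ b≤b′)))) us y q)) (+-identityʳ _))))
        (restrict f S σ a b lorₛ)
      ... | no n≰x | no n≰y | yes x+2≤n | _ = merge-lorentzian f σ a b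
        (Vec.replicate m 0ℤ , 1ℤ , 0ℤ , subst (0ℤ <_) (sym (grad-y (λ τ → f (B ∷ τ)) σ a b))
          (pos (B ∷ σ) (suc a) b (subst (λ k → suc k ℕ.≤ n) (sym (ℕₚ.+-suc x a)) x+2≤n) (ℕₚ.≰⇒> n≰y)
            (trans (rearrange x y a b r) total)))
        lorₛ lorₜ
        where
        rearrange : ∀ x y a b r → suc x ℕ.+ suc a ℕ.+ (suc y ℕ.+ b) ℕ.+ r ≡ x ℕ.+ a ℕ.+ (y ℕ.+ b) ℕ.+ (3 ℕ.+ r)
        rearrange = ℕ-Solver.solve-∀
      ... | no n≰x | no n≰y | no _ | yes y+2≤n = merge-lorentzian f σ a b
        (Vec.replicate m 0ℤ , 0ℤ , 1ℤ , subst (0ℤ <_) (sym (grad-q (λ τ → f (B ∷ τ)) σ a b))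
          (pos (B ∷ σ) a (suc b) (ℕₚ.≰⇒> n≰x) (subst (λ k → suc k ℕ.≤ n) (sym (ℕₚ.+-suc y b)) y+2≤n)
            (trans (rearrange x y a b r) total)))
        lorₛ lorₜ
        where
        rearrange : ∀ x y a b r → suc x ℕ.+ a ℕ.+ (suc y ℕ.+ suc b) ℕ.+ r ≡ x ℕ.+ a ℕ.+ (y ℕ.+ b) ℕ.+ (3 ℕ.+ r)
        rearrange = ℕ-Solver.solve-∀
      ... | no n≰x | no n≰y | no x+2≰n | no y+2≰n = ⊥-elim (ℕₚ.<⇒≱
        (subst (suc (suc (x ℕ.+ a) ℕ.+ suc (y ℕ.+ b)) ℕ.≤_) (trans (rearrange x y a b r) total) (ℕₚ.m≤m+n _ r))
        (ℕₚ.+-mono-≤ (ℕ.s≤s⁻¹ (ℕₚ.≰⇒> x+2≰n)) (ℕ.s≤s⁻¹ (ℕₚ.≰⇒> y+2≰n))))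
        where
        rearrange : ∀ x y a b r → suc (suc (x ℕ.+ a) ℕ.+ suc (y ℕ.+ b)) ℕ.+ r ≡ x ℕ.+ a ℕ.+ (y ℕ.+ b) ℕ.+ (3 ℕ.+ r)
        rearrange = ℕ-Solver.solve-∀

  collapse : ∀ {m} → Derivatives m → ℕ → ℕ → ℤ
  collapse {zero}  f = f []
  collapse {suc m} f = collapse (merge f)

  collapse-lorentzian : ∀ {n r m} (f : Derivatives m) → m ℕ.+ r ≡ n → Good n r f →
    ∀ a b → 2 ℕ.+ (a ℕ.+ b) ≡ n → Lorentzian {0} (λ _ → collapse f) [] a b
  collapse-lorentzian {m = zero}  f size good a b ab with Good.lorentzian good [] a b ab
  ... | c , 0<c , ℓ , bound = c , 0<c , ℓ , λ { [] y q → bound [] y q }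
  collapse-lorentzian {r = r} {m = suc m} f size good a b ab =
    collapse-lorentzian (merge f) (trans (ℕₚ.+-suc m r) size) (merge-good f size good) a b ab

  discriminant : ∀ {c d e p r s : ℤ} → 0ℤ < c → 0ℤ ≤ p →
    (∀ y q → c * (y * y * p + (y + y) * q * r + q * q * s) ≤ sq (y * d + q * e)) → p * s ≤ r * r
  discriminant {c} {d} {e} {p} {r} {s} 0<c 0≤p bound with p * s ≤? r * r
  ... | yes ps≤r² = ps≤r²
  ... | no  ps≰r² = ⊥-elim (<⇒≱ 0<p p≤0)
    where
    0<Δ : 0ℤ < p * s - r * r
    0<Δ = subst (_< p * s - r * r) (+-inverseʳ (r * r)) (+-monoˡ-< (- (r * r)) (≰⇒> ps≰r²))
    0<p : 0ℤ < p
    0<p = ≤∧≢⇒< 0≤p λ { refl → <⇒≱ (≰⇒> ps≰r²) (0≤sq r) }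
    isotropic : e * e * p + (e + e) * (- d) * r + (- d) * (- d) * s ≤ 0ℤ
    isotropic = cancel-pos 0<c (subst (c * (e * e * p + (e + e) * (- d) * r + (- d) * (- d) * s) ≤_)
        (trans (vanish d e) (sym (*-zeroʳ c))) (bound e (- d)))
      where
      vanish : ∀ d e → (e * d + - d * e) * (e * d + - d * e) ≡ 0ℤ
      vanish = solve-∀
    completed : sq (p * e - r * d) + (p * s - r * r) * sq d ≤ 0ℤ
    completed = by-difference (0≤* 0≤p (difference isotropic)) (identity d e p r s)
      where
      identity : ∀ d e p r s →
        p * (0ℤ - (e * e * p + (e + e) * (- d) * r + (- d) * (- d) * s)) ≡
        0ℤ - ((p * e - r * d) * (p * e - r * d) + (p * s - r * r) * (d * d))
      identity = solve-∀
    zero-square : ∀ {x} → sq x ≤ 0ℤ → x ≡ 0ℤ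
    zero-square {x} x²≤0 with x ≟ 0ℤ
    ... | yes x≡0 = x≡0
    ... | no  x≢0 = ⊥-elim (<⇒≱ (0<sq x≢0) x²≤0)
    d≡0 : d ≡ 0ℤ
    d≡0 = zero-square (cancel-pos 0<Δ (≤-trans (by-difference (0≤sq (p * e - r * d)) (identity (sq (p * e - r * d)) _))
        (≤-trans completed (≤-reflexive (sym (*-zeroʳ (p * s - r * r)))))))
      where
      identity : ∀ x y → x ≡ x + y - y
      identity = solve-∀
    p≤0 : p ≤ 0ℤ
    p≤0 = cancel-pos 0<c (subst₂ _≤_ (identity c p r s) (trans (cong (λ z → sq (1ℤ * z + 0ℤ * e)) d≡0) (sym (*-zeroʳ c))) (bound 1ℤ 0ℤ))
      where
      identity : ∀ c p r s → c * (1ℤ * 1ℤ * p + (1ℤ + 1ℤ) * 0ℤ * r + 0ℤ * 0ℤ * s) ≡ c * p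
      identity = solve-∀

  -- Weights on subsets and the product of two generating polynomials

  linₛ : ∀ {m} → (Subset m → ℤ) → Subset m → Vec ℤ m → ℤ
  linₛ Φ []          []       = 0ℤ
  linₛ Φ (true  ∷ p) (u ∷ us) = linₛ (λ q → Φ (inside ∷ q)) p us
  linₛ Φ (false ∷ p) (u ∷ us) = u * Φ (inside ∷ p) + linₛ (λ q → Φ (outside ∷ q)) p us

  quadₛ : ∀ {m} → (Subset m → ℤ) → Subset m → Vec ℤ m → ℤ
  quadₛ Φ []          []       = 0ℤ
  quadₛ Φ (true  ∷ p) (u ∷ us) = quadₛ (λ q → Φ (inside ∷ q)) p us
  quadₛ Φ (false ∷ p) (u ∷ us) =
    (u + u) * linₛ (λ q → Φ (inside ∷ q)) p us + quadₛ (λ q → Φ (outside ∷ q)) p us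

  linₛ-cong : ∀ {m} {Φ Ψ : Subset m → ℤ} p → (∀ q → card q ≡ suc (card p) → Φ q ≡ Ψ q) →
    ∀ us → linₛ Φ p us ≡ linₛ Ψ p us
  linₛ-cong []          Φ≡Ψ []       = refl
  linₛ-cong (true  ∷ p) Φ≡Ψ (u ∷ us) = linₛ-cong p (λ q eq → Φ≡Ψ (inside ∷ q) (cong suc eq)) us
  linₛ-cong (false ∷ p) Φ≡Ψ (u ∷ us) =
    cong₂ (λ x y → u * x + y) (Φ≡Ψ (inside ∷ p) refl) (linₛ-cong p (λ q eq → Φ≡Ψ (outside ∷ q) eq) us)

  quadₛ-cong : ∀ {m} {Φ Ψ : Subset m → ℤ} p → (∀ q → card q ≡ suc (suc (card p)) → Φ q ≡ Ψ q) →
    ∀ us → quadₛ Φ p us ≡ quadₛ Ψ p us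
  quadₛ-cong []          Φ≡Ψ []       = refl
  quadₛ-cong (true  ∷ p) Φ≡Ψ (u ∷ us) = quadₛ-cong p (λ q eq → Φ≡Ψ (inside ∷ q) (cong suc eq)) us
  quadₛ-cong (false ∷ p) Φ≡Ψ (u ∷ us) =
    cong₂ (λ x y → (u + u) * x + y) (linₛ-cong p (λ q eq → Φ≡Ψ (inside ∷ q) (cong suc eq)) us)
          (quadₛ-cong p (λ q eq → Φ≡Ψ (outside ∷ q) eq) us)

  linₛ-zero : ∀ {m} (p : Subset m) us → linₛ (λ _ → 0ℤ) p us ≡ 0ℤ
  linₛ-zero []          []       = refl
  linₛ-zero (true  ∷ p) (u ∷ us) = linₛ-zero p us
  linₛ-zero (false ∷ p) (u ∷ us) = cong₂ _+_ (*-zeroʳ u) (linₛ-zero p us)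

  quadₛ-zero : ∀ {m} (p : Subset m) us → quadₛ (λ _ → 0ℤ) p us ≡ 0ℤ
  quadₛ-zero []          []       = refl
  quadₛ-zero (true  ∷ p) (u ∷ us) = quadₛ-zero p us
  quadₛ-zero (false ∷ p) (u ∷ us) =
    cong₂ _+_ (trans (cong ((u + u) *_) (linₛ-zero p us)) (*-zeroʳ (u + u))) (quadₛ-zero p us)

  linₛ-coeffs : ∀ {m} → (Subset m → ℤ) → Subset m → Vec ℤ m
  linₛ-coeffs Φ []          = []
  linₛ-coeffs Φ (true  ∷ p) = 0ℤ ∷ linₛ-coeffs (λ q → Φ (inside ∷ q)) p
  linₛ-coeffs Φ (false ∷ p) = Φ (inside ∷ p) ∷ linₛ-coeffs (λ q → Φ (outside ∷ q)) p

  linₛ≡dot : ∀ {m} (Φ : Subset m → ℤ) p us → linₛ Φ p us ≡ dot (linₛ-coeffs Φ p) us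
  linₛ≡dot Φ []          []       = refl
  linₛ≡dot Φ (true  ∷ p) (u ∷ us) =
    trans (linₛ≡dot (λ q → Φ (inside ∷ q)) p us) (sym (trans (cong (_+ dot cs us) (*-zeroʳ u)) (+-identityˡ (dot cs us))))
    where
    cs : Vec ℤ _
    cs = linₛ-coeffs (λ q → Φ (inside ∷ q)) p
  linₛ≡dot Φ (false ∷ p) (u ∷ us) =
    cong (λ z → u * Φ (inside ∷ p) + z) (linₛ≡dot (λ q → Φ (outside ∷ q)) p us)

  occupiedˣ occupiedʷ : State → Bool
  occupiedˣ S = true
  occupiedˣ T = false
  occupiedˣ B = true
  occupiedʷ S = false
  occupiedʷ T = true
  occupiedʷ B = true

  supportˣ supportʷ : ∀ {m} → Vec State m → Subset m
  supportˣ = Vec.map occupiedˣ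
  supportʷ = Vec.map occupiedʷ

  card-supportˣ : ∀ {m} (σ : Vec State m) → card (supportˣ σ) ≡ degˣ σ
  card-supportˣ []      = refl
  card-supportˣ (S ∷ σ) = cong suc (card-supportˣ σ)
  card-supportˣ (T ∷ σ) = card-supportˣ σ
  card-supportˣ (B ∷ σ) = cong suc (card-supportˣ σ)

  card-supportʷ : ∀ {m} (σ : Vec State m) → card (supportʷ σ) ≡ degʷ σ
  card-supportʷ []      = refl
  card-supportʷ (S ∷ σ) = card-supportʷ σ
  card-supportʷ (T ∷ σ) = cong suc (card-supportʷ σ)
  card-supportʷ (B ∷ σ) = cong suc (card-supportʷ σ)

  supportˣ-states : ∀ {m} (p : Subset m) → supportˣ (states p) ≡ p
  supportˣ-states []          = refl
  supportˣ-states (true  ∷ p) = cong (inside ∷_) (supportˣ-states p)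
  supportˣ-states (false ∷ p) = cong (outside ∷_) (supportˣ-states p)

  supportʷ-states : ∀ {m} (p : Subset m) → supportʷ (states p) ≡ ∁ p
  supportʷ-states []          = refl
  supportʷ-states (true  ∷ p) = cong (outside ∷_) (supportʷ-states p)
  supportʷ-states (false ∷ p) = cong (inside ∷_) (supportʷ-states p)

  product : ∀ {m} → (Subset m → ℤ) → (Subset m → ℤ) → Vec State m → ℤ
  product F G σ = F (supportˣ σ) * G (supportʷ σ)

  product-states : ∀ {m} (F G : Subset m → ℤ) p → product F G (states p) ≡ F p * G (∁ p)
  product-states F G p = cong₂ (λ q r → F q * G r) (supportˣ-states p) (supportʷ-states p)

  -- Product rule: a variable already used on one side can only differentiate the other factor.
  lin-product : ∀ {m} (F G : Subset m → ℤ) p us →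
    lin (product F G) (states p) us ≡ linₛ F p us * G (∁ p) + F p * linₛ G (∁ p) us
  lin-product F G []          []       = sym (identity (F []) (G []))
    where
    identity : ∀ x y → 0ℤ * y + x * 0ℤ ≡ 0ℤ
    identity = solve-∀
  lin-product F G (true  ∷ p) (u ∷ us) =
    trans (cong₂ (λ x y → u * x + y) (product-states (λ q → F (inside ∷ q)) (λ q → G (inside ∷ q)) p)
                                     (lin-product (λ q → F (inside ∷ q)) (λ q → G (outside ∷ q)) p us))
          (identity u (F (inside ∷ p)) (G (inside ∷ ∁ p)) (linₛ (λ q → F (inside ∷ q)) p us)
             (G (outside ∷ ∁ p)) (linₛ (λ q → G (outside ∷ q)) (∁ p) us))
    where
    identity : ∀ u f g l g′ l′ → u * (f * g) + (l * g′ + f * l′) ≡ l * g′ + f * (u * g + l′)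
    identity = solve-∀
  lin-product F G (false ∷ p) (u ∷ us) =
    trans (cong₂ (λ x y → u * x + y) (product-states (λ q → F (inside ∷ q)) (λ q → G (inside ∷ q)) p)
                                     (lin-product (λ q → F (outside ∷ q)) (λ q → G (inside ∷ q)) p us))
          (identity u (F (inside ∷ p)) (G (inside ∷ ∁ p)) (linₛ (λ q → F (outside ∷ q)) p us)
             (F (outside ∷ p)) (linₛ (λ q → G (inside ∷ q)) (∁ p) us))
    where
    identity : ∀ u f g l f′ l′ → u * (f * g) + (l * g + f′ * l′) ≡ (u * f + l) * g + f′ * l′
    identity = solve-∀

  quad-product : ∀ {m} (F G : Subset m → ℤ) p us → let l = linₛ F p us * linₛ G (∁ p) us in
    quad (product F G) (states p) us ≡ quadₛ F p us * G (∁ p) + (l + l) + F p * quadₛ G (∁ p) us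
  quad-product F G []          []       = sym (identity (F []) (G []))
    where
    identity : ∀ x y → 0ℤ * y + (0ℤ * 0ℤ + 0ℤ * 0ℤ) + x * 0ℤ ≡ 0ℤ
    identity = solve-∀
  quad-product F G (true  ∷ p) (u ∷ us) =
    trans (cong₂ (λ x y → (u + u) * x + y) (lin-product Fᵢ Gᵢ p us) (quad-product Fᵢ Gₒ p us))
          (identity u (linₛ Fᵢ p us) (Gᵢ (∁ p)) (Fᵢ p) (linₛ Gᵢ (∁ p) us)
                    (quadₛ Fᵢ p us) (Gₒ (∁ p)) (linₛ Gₒ (∁ p) us) (quadₛ Gₒ (∁ p) us))
    where
    Fᵢ Gᵢ Gₒ : Subset _ → ℤ
    Fᵢ q = F (inside ∷ q)
    Gᵢ q = G (inside ∷ q)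
    Gₒ q = G (outside ∷ q)
    identity : ∀ u lF g f lG qF g′ lG′ qG →
      (u + u) * (lF * g + f * lG) + (qF * g′ + (lF * lG′ + lF * lG′) + f * qG) ≡
      qF * g′ + (lF * (u * g + lG′) + lF * (u * g + lG′)) + f * ((u + u) * lG + qG)
    identity = solve-∀
  quad-product F G (false ∷ p) (u ∷ us) =
    trans (cong₂ (λ x y → (u + u) * x + y) (lin-product Fᵢ Gᵢ p us) (quad-product Fₒ Gᵢ p us))
          (identity u (linₛ Fᵢ p us) (Gᵢ (∁ p)) (Fᵢ p) (linₛ Gᵢ (∁ p) us)
                    (quadₛ Fₒ p us) (linₛ Fₒ p us) (Fₒ p) (quadₛ Gᵢ (∁ p) us))
    where
    Fᵢ Fₒ Gᵢ : Subset _ → ℤ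
    Fᵢ q = F (inside ∷ q)
    Fₒ q = F (outside ∷ q)
    Gᵢ q = G (inside ∷ q)
    identity : ∀ u lF g f lG qF lF′ f′ qG →
      (u + u) * (lF * g + f * lG) + (qF * g + (lF′ * lG + lF′ * lG) + f′ * qG) ≡
      ((u + u) * lF + qF) * g + ((u * f + lF′) * lG + (u * f + lF′) * lG) + f′ * qG
    identity = solve-∀

  -- The derivative ∂_x^p ∂_y^a of Σ_p Φ(p)/(n-|p|)! x^p y^(n-|p|) at the origin.
  level : ∀ {m} → ℕ → (Subset m → ℤ) → ℕ → Subset m → ℤ
  level n Φ a p with card p ℕ.+ a ℕₚ.≟ n
  ... | yes _ = Φ p
  ... | no  _ = 0ℤ

  level-≡ : ∀ {m n a} (Φ : Subset m → ℤ) p → card p ℕ.+ a ≡ n → level n Φ a p ≡ Φ p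
  level-≡ {n = n} {a} Φ p eq with card p ℕ.+ a ℕₚ.≟ n
  ... | yes _  = refl
  ... | no  ¬e = ⊥-elim (¬e eq)

  level-≢ : ∀ {m n a} (Φ : Subset m → ℤ) p → ¬ card p ℕ.+ a ≡ n → level n Φ a p ≡ 0ℤ
  level-≢ {n = n} {a} Φ p neq with card p ℕ.+ a ℕₚ.≟ n
  ... | yes e = ⊥-elim (neq e)
  ... | no  _ = refl

  level-nonneg : ∀ {m n a} (Φ : Subset m → ℤ) p → 0ℤ ≤ Φ p → 0ℤ ≤ level n Φ a p
  level-nonneg {n = n} {a} Φ p 0≤Φ with card p ℕ.+ a ℕₚ.≟ n
  ... | yes _ = 0≤Φ
  ... | no  _ = ≤-refl

  first : ∀ {m} → (Subset m → ℤ) → Subset m → Vec ℤ m → ℤ → ℤ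
  first Φ p us y = linₛ Φ p us + y * Φ p

  second : ∀ {m} → (Subset m → ℤ) → Subset m → Vec ℤ m → ℤ → ℤ
  second Φ p us y = quadₛ Φ p us + (y + y) * linₛ Φ p us + y * y * Φ p

  first-level : ∀ {m} → ℕ → (Subset m → ℤ) → ℕ → Subset m → Vec ℤ m → ℤ → ℤ
  first-level n Φ a p us y = linₛ (level n Φ a) p us + y * level n Φ (suc a) p

  second-level : ∀ {m} → ℕ → (Subset m → ℤ) → ℕ → Subset m → Vec ℤ m → ℤ → ℤ
  second-level n Φ a p us y =
    quadₛ (level n Φ a) p us + (y + y) * linₛ (level n Φ (suc a)) p us + y * y * level n Φ (suc (suc a)) p

  module _ {m n : ℕ} (Φ : Subset m → ℤ) (p : Subset m) where

    private
      shift : ∀ k {a c} → c ≡ k ℕ.+ card p → c ℕ.+ a ≡ card p ℕ.+ (k ℕ.+ a)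
      shift k {a} eq = trans (cong (ℕ._+ a) eq) (trans (cong (ℕ._+ a) (ℕₚ.+-comm k (card p))) (ℕₚ.+-assoc (card p) k a))

    linₛ-level-≡ : ∀ {a} → card p ℕ.+ suc a ≡ n → ∀ us → linₛ (level n Φ a) p us ≡ linₛ Φ p us
    linₛ-level-≡ eq = linₛ-cong p λ q c → level-≡ Φ q (trans (shift 1 c) eq)

    linₛ-level-≢ : ∀ {a} → ¬ card p ℕ.+ suc a ≡ n → ∀ us → linₛ (level n Φ a) p us ≡ 0ℤ
    linₛ-level-≢ neq us =
      trans (linₛ-cong p (λ q c → level-≢ Φ q (λ e → neq (trans (sym (shift 1 c)) e))) us) (linₛ-zero p us)

    quadₛ-level-≡ : ∀ {a} → card p ℕ.+ suc (suc a) ≡ n → ∀ us → quadₛ (level n Φ a) p us ≡ quadₛ Φ p us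
    quadₛ-level-≡ eq = quadₛ-cong p λ q c → level-≡ Φ q (trans (shift 2 c) eq)

    quadₛ-level-≢ : ∀ {a} → ¬ card p ℕ.+ suc (suc a) ≡ n → ∀ us → quadₛ (level n Φ a) p us ≡ 0ℤ
    quadₛ-level-≢ neq us =
      trans (quadₛ-cong p (λ q c → level-≢ Φ q (λ e → neq (trans (sym (shift 2 c)) e))) us) (quadₛ-zero p us)

    first-level-≡ : ∀ {a} → card p ℕ.+ suc a ≡ n → ∀ us y → first-level n Φ a p us y ≡ first Φ p us y
    first-level-≡ eq us y = cong₂ (λ l v → l + y * v) (linₛ-level-≡ eq us) (level-≡ Φ p eq)

    first-level-≢ : ∀ {a} → ¬ card p ℕ.+ suc a ≡ n → ∀ us y → first-level n Φ a p us y ≡ 0ℤ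
    first-level-≢ neq us y =
      trans (cong₂ (λ l v → l + y * v) (linₛ-level-≢ neq us) (level-≢ Φ p neq)) (trans (+-identityˡ (y * 0ℤ)) (*-zeroʳ y))

    second-level-≡ : ∀ {a} → card p ℕ.+ suc (suc a) ≡ n → ∀ us y → second-level n Φ a p us y ≡ second Φ p us y
    second-level-≡ eq us y =
      cong₂ (λ x v → x + y * y * v)
        (cong₂ (λ x l → x + (y + y) * l) (quadₛ-level-≡ eq us) (linₛ-level-≡ eq us)) (level-≡ Φ p eq)

    second-level-≢ : ∀ {a} → ¬ card p ℕ.+ suc (suc a) ≡ n → ∀ us y → second-level n Φ a p us y ≡ 0ℤ
    second-level-≢ neq us y = trans
      (cong₂ (λ x v → x + y * y * v)
        (cong₂ (λ x l → x + (y + y) * l) (quadₛ-level-≢ neq us) (linₛ-level-≢ neq us)) (level-≢ Φ p neq))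
      (identity y)
      where
      identity : ∀ y → 0ℤ + (y + y) * 0ℤ + y * y * 0ℤ ≡ 0ℤ
      identity = solve-∀

  record LogConcaveWeight {m} (Φ : Subset m → ℤ) : Set where
    field
      weight-pos : ∀ p → 0ℤ < Φ p
      quadₛ≤linₛ² : ∀ p us → Φ p * quadₛ Φ p us ≤ sq (linₛ Φ p us)

    second≤first² : ∀ p us y → Φ p * second Φ p us y ≤ sq (first Φ p us y)
    second≤first² p us y = by-difference (difference (quadₛ≤linₛ² p us)) (identity (Φ p) (quadₛ Φ p us) (linₛ Φ p us) y)
      where
      identity : ∀ φ Q l y → l * l - φ * Q ≡ (l + y * φ) * (l + y * φ) - φ * (Q + (y + y) * l + y * y * φ)
      identity = solve-∀

  paired : ∀ {m} → ℕ → (Subset m → ℤ) → (Subset m → ℤ) → Derivatives m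
  paired n Φ Ψ σ a b = product (level n Φ a) (level n Ψ b) σ

  hess-paired : ∀ {m} n (Φ Ψ : Subset m → ℤ) p a b us y q →
    let d = first-level n Φ a p us y * first-level n Ψ b (∁ p) us q in
    hess (paired n Φ Ψ) (states p) a b us y q ≡
    second-level n Φ a p us y * level n Ψ b (∁ p) + (d + d) + level n Φ a p * second-level n Ψ b (∁ p) us q
  hess-paired n Φ Ψ p a b us y q = trans
    (cong₂ _+_
      (cong₂ _+_ (quad-product (F a) (G b) p us)
                 (cong₂ (λ x z → (y + y) * x + (q + q) * z)
                    (lin-product (F (suc a)) (G b) p us) (lin-product (F a) (G (suc b)) p us)))
      (cong₂ _+_ (cong₂ (λ x z → y * y * x + (y + y) * q * z)
                    (product-states (F (suc (suc a))) (G b) p) (product-states (F (suc a)) (G (suc b)) p))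
                 (cong (λ x → q * q * x) (product-states (F a) (G (suc (suc b))) p))))
    (identity y q (F a p) (F (suc a) p) (F (suc (suc a)) p) (G b (∁ p)) (G (suc b) (∁ p)) (G (suc (suc b)) (∁ p))
       (linₛ (F a) p us) (linₛ (F (suc a)) p us) (linₛ (G b) (∁ p) us) (linₛ (G (suc b)) (∁ p) us)
       (quadₛ (F a) p us) (quadₛ (G b) (∁ p) us))
    where
    F G : ℕ → Subset _ → ℤ
    F = level n Φ
    G = level n Ψ
    identity : ∀ y q f₀ f₁ f₂ g₀ g₁ g₂ lf₀ lf₁ lg₀ lg₁ qf qg →
      qf * g₀ + (lf₀ * lg₀ + lf₀ * lg₀) + f₀ * qg
        + ((y + y) * (lf₁ * g₀ + f₁ * lg₀) + (q + q) * (lf₀ * g₁ + f₀ * lg₁))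
        + (y * y * (f₂ * g₀) + (y + y) * q * (f₁ * g₁) + q * q * (f₀ * g₂))
      ≡ (qf + (y + y) * lf₁ + y * y * f₂) * g₀
        + ((lf₀ + y * f₁) * (lg₀ + q * g₁) + (lf₀ + y * f₁) * (lg₀ + q * g₁))
        + f₀ * (qg + (q + q) * lg₁ + q * q * g₂)
    identity = solve-∀

  firstʸ firstᵠ : ∀ {m} → (Subset m → ℤ) → Subset m → Functional m
  firstʸ Φ p = functional (linₛ-coeffs Φ p) (Φ p) 0ℤ
  firstᵠ Φ p = functional (linₛ-coeffs Φ p) 0ℤ (Φ p)

  first≡⟦firstʸ⟧ : ∀ {m} (Φ : Subset m → ℤ) p us y q → first Φ p us y ≡ ⟦ firstʸ Φ p ⟧ us y q
  first≡⟦firstʸ⟧ Φ p us y q = trans (cong (_+ y * Φ p) (linₛ≡dot Φ p us)) (identity (dot (linₛ-coeffs Φ p) us) y (Φ p) q)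
    where
    identity : ∀ d y φ q → d + y * φ ≡ d + (y * φ + q * 0ℤ)
    identity = solve-∀

  first≡⟦firstᵠ⟧ : ∀ {m} (Φ : Subset m → ℤ) p us y q → first Φ p us q ≡ ⟦ firstᵠ Φ p ⟧ us y q
  first≡⟦firstᵠ⟧ Φ p us y q = trans (cong (_+ q * Φ p) (linₛ≡dot Φ p us)) (identity (dot (linₛ-coeffs Φ p) us) y (Φ p) q)
    where
    identity : ∀ d y φ q → d + q * φ ≡ d + (y * 0ℤ + q * φ)
    identity = solve-∀

  module _ {n : ℕ} {Φ Ψ : Subset n → ℤ} (lcΦ : LogConcaveWeight Φ) (lcΨ : LogConcaveWeight Ψ) where

    private
      module Φ = LogConcaveWeight lcΦ
      module Ψ = LogConcaveWeight lcΨ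

    paired-zeroˣ : ∀ σ a b → n ℕ.< degˣ σ ℕ.+ a → paired n Φ Ψ σ a b ≡ 0ℤ
    paired-zeroˣ σ a b n< = trans (cong (_* level n Ψ b (supportʷ σ)) (level-≢ Φ (supportˣ σ)
        λ e → ℕₚ.<-irrefl (sym (trans (cong (ℕ._+ a) (sym (card-supportˣ σ))) e)) n<))
      (*-zeroˡ (level n Ψ b (supportʷ σ)))

    paired-zeroʷ : ∀ σ a b → n ℕ.< degʷ σ ℕ.+ b → paired n Φ Ψ σ a b ≡ 0ℤ
    paired-zeroʷ σ a b n< = trans (cong (level n Φ a (supportˣ σ) *_) (level-≢ Ψ (supportʷ σ)
        λ e → ℕₚ.<-irrefl (sym (trans (cong (ℕ._+ b) (sym (card-supportʷ σ))) e)) n<))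
      (*-zeroʳ (level n Φ a (supportˣ σ)))

    paired-pos : ∀ σ a b → degˣ σ ℕ.+ a ≡ n → degʷ σ ℕ.+ b ≡ n → 0ℤ < paired n Φ Ψ σ a b
    paired-pos σ a b x≡n w≡n = subst (0ℤ <_)
      (sym (cong₂ _*_ (level-≡ Φ (supportˣ σ) (trans (cong (ℕ._+ a) (card-supportˣ σ)) x≡n))
                      (level-≡ Ψ (supportʷ σ) (trans (cong (ℕ._+ b) (card-supportʷ σ)) w≡n))))
      (0<* (Φ.weight-pos (supportˣ σ)) (Ψ.weight-pos (supportʷ σ)))

    vanishing : ∀ (σ : Vec State n) a b → (∀ us y q → hess (paired n Φ Ψ) σ a b us y q ≡ 0ℤ) →
      Lorentzian (paired n Φ Ψ) σ a b
    vanishing σ a b hess≡0 = 1ℤ , +<+ ℕ.z<s , functional (Vec.replicate n 0ℤ) 0ℤ 0ℤ , λ us y q →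
      subst (λ h → 1ℤ * h ≤ sq (⟦ functional (Vec.replicate n 0ℤ) 0ℤ 0ℤ ⟧ us y q)) (sym (hess≡0 us y q))
        (0≤sq (⟦ functional (Vec.replicate n 0ℤ) 0ℤ 0ℤ ⟧ us y q))

    paired-lorentzian : ∀ p a b → 2 ℕ.+ (a ℕ.+ b) ≡ n → Lorentzian (paired n Φ Ψ) (states p) a b
    paired-lorentzian p a b ab with card p ℕ.+ a ℕₚ.≤? n | card (∁ p) ℕ.+ b ℕₚ.≤? n
    ... | no x≰n | _ = vanishing (states p) a b (hess-zero weightˣ≤B (paired n Φ Ψ) (states p) a b
        λ τ a′ b′ σ≤τ a≤a′ _ → paired-zeroˣ τ a′ b′ (ℕₚ.<-≤-trans (ℕₚ.≰⇒> x≰n)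
          (ℕₚ.+-mono-≤ (ℕₚ.≤-trans (ℕₚ.≤-reflexive (trans (cong card (sym (supportˣ-states p))) (card-supportˣ (states p)))) σ≤τ) a≤a′)))
    ... | yes _ | no w≰n = vanishing (states p) a b (hess-zero weightʷ≤B (paired n Φ Ψ) (states p) a b
        λ τ a′ b′ σ≤τ _ b≤b′ → paired-zeroʷ τ a′ b′ (ℕₚ.<-≤-trans (ℕₚ.≰⇒> w≰n)
          (ℕₚ.+-mono-≤ (ℕₚ.≤-trans (ℕₚ.≤-reflexive (trans (cong card (sym (supportʷ-states p))) (card-supportʷ (states p)))) σ≤τ) b≤b′)))
    ... | yes x≤n | yes w≤n with ℕₚ.m≤n⇒∃[o]m+o≡n x≤n | ℕₚ.m≤n⇒∃[o]m+o≡n w≤n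
    ... | i , xi | j , wj = by-codegree i j i+j≡2 xi wj
      where
      x+w≡n : card p ℕ.+ card (∁ p) ≡ n
      x+w≡n = trans (cong₂ ℕ._+_ (trans (cong card (sym (supportˣ-states p))) (card-supportˣ (states p)))
                                 (trans (cong card (sym (supportʷ-states p))) (card-supportʷ (states p)))) (degˣ+degʷ p)
      i+j≡2 : i ℕ.+ j ≡ 2
      i+j≡2 = ℕₚ.+-cancelˡ-≡ (card p ℕ.+ card (∁ p) ℕ.+ (a ℕ.+ b)) _ _ (begin
        card p ℕ.+ card (∁ p) ℕ.+ (a ℕ.+ b) ℕ.+ (i ℕ.+ j)   ≡⟨ rearrange (card p) (card (∁ p)) a b i j ⟩
        card p ℕ.+ a ℕ.+ i ℕ.+ (card (∁ p) ℕ.+ b ℕ.+ j)     ≡⟨ cong₂ ℕ._+_ xi wj ⟩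
        n ℕ.+ n                                             ≡⟨ cong₂ ℕ._+_ x+w≡n ab ⟨
        card p ℕ.+ card (∁ p) ℕ.+ (2 ℕ.+ (a ℕ.+ b))         ≡⟨ rearrange′ (card p ℕ.+ card (∁ p)) (a ℕ.+ b) ⟩
        card p ℕ.+ card (∁ p) ℕ.+ (a ℕ.+ b) ℕ.+ 2           ∎)
        where
        open ≡-Reasoning
        rearrange : ∀ x w a b i j → x ℕ.+ w ℕ.+ (a ℕ.+ b) ℕ.+ (i ℕ.+ j) ≡ x ℕ.+ a ℕ.+ i ℕ.+ (w ℕ.+ b ℕ.+ j)
        rearrange = ℕ-Solver.solve-∀
        rearrange′ : ∀ x c → x ℕ.+ (2 ℕ.+ c) ≡ x ℕ.+ c ℕ.+ 2
        rearrange′ = ℕ-Solver.solve-∀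

      too-big : ∀ {x c} k → x ℕ.+ c ≡ n → ¬ x ℕ.+ (suc k ℕ.+ c) ≡ n
      too-big {x} {c} k e e′ = ℕₚ.m≢1+n+m c (ℕₚ.+-cancelˡ-≡ x c (suc k ℕ.+ c) (trans e (sym e′)))

      by-codegree : ∀ i j → i ℕ.+ j ≡ 2 → card p ℕ.+ a ℕ.+ i ≡ n → card (∁ p) ℕ.+ b ℕ.+ j ≡ n →
        Lorentzian (paired n Φ Ψ) (states p) a b
      by-codegree 0 _ refl xi wj = φ * ψ , 0<* (Φ.weight-pos p) (Ψ.weight-pos (∁ p)) , φ ⊠ firstᵠ Ψ (∁ p) , λ us y q →
        subst₂ _≤_ (trans (assoc φ ψ (second Ψ (∁ p) us q)) (cong (φ * ψ *_) (sym (hess≡ us y q))))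
          (cong sq (trans (cong (φ *_) (first≡⟦firstᵠ⟧ Ψ (∁ p) us y q)) (sym (⟦⟧-⊠ φ (firstᵠ Ψ (∁ p)) us y q))))
          (scaled us q)
        where
        φ ψ : ℤ
        φ = Φ p
        ψ = Ψ (∁ p)
        xa : card p ℕ.+ a ≡ n
        xa = trans (sym (ℕₚ.+-identityʳ _)) xi
        wb : card (∁ p) ℕ.+ suc (suc b) ≡ n
        wb = trans (rearrange (card (∁ p)) b) wj
          where
          rearrange : ∀ w b → w ℕ.+ suc (suc b) ≡ w ℕ.+ b ℕ.+ 2
          rearrange = ℕ-Solver.solve-∀
        assoc : ∀ φ ψ Q → φ * φ * (ψ * Q) ≡ φ * ψ * (φ * Q)
        assoc = solve-∀
        scaled : ∀ us q → φ * φ * (ψ * second Ψ (∁ p) us q) ≤ sq (φ * first Ψ (∁ p) us q)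
        scaled us q = by-difference (0≤* (0≤sq φ) (difference (Ψ.second≤first² (∁ p) us q)))
          (identity φ (ψ * second Ψ (∁ p) us q) (first Ψ (∁ p) us q))
          where
          identity : ∀ φ Q l → φ * φ * (l * l - Q) ≡ φ * l * (φ * l) - φ * φ * Q
          identity = solve-∀
        hess≡ : ∀ us y q → hess (paired n Φ Ψ) (states p) a b us y q ≡ φ * second Ψ (∁ p) us q
        hess≡ us y q = trans (hess-paired n Φ Ψ p a b us y q) (trans
            (cong₂ _+_ (cong₂ _+_ (cong (_* g) (second-level-≢ Φ p (too-big 1 xa) us y))
                                    (cong (λ z → z * l + z * l) (first-level-≢ Φ p (too-big 0 xa) us y)))
                         (cong₂ _*_ (level-≡ Φ p xa) (second-level-≡ Ψ (∁ p) wb us q)))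
              (identity g l (φ * second Ψ (∁ p) us q)))
          where
          g l : ℤ
          g = level n Ψ b (∁ p)
          l = first-level n Ψ b (∁ p) us q
          identity : ∀ g l Q → 0ℤ * g + (0ℤ * l + 0ℤ * l) + Q ≡ Q
          identity = solve-∀
      by-codegree 1 _ refl xi wj = 1ℤ , +<+ ℕ.z<s , firstʸ Φ p ⊞ firstᵠ Ψ (∁ p) , λ us y q →
        subst₂ _≤_ (cong (1ℤ *_) (sym (hess≡ us y q)))
          (cong sq (trans (cong₂ _+_ (first≡⟦firstʸ⟧ Φ p us y q) (first≡⟦firstᵠ⟧ Ψ (∁ p) us y q))
                          (sym (⟦⟧-⊞ (firstʸ Φ p) (firstᵠ Ψ (∁ p)) us y q))))
          (by-difference (0≤+ (0≤sq (first Φ p us y)) (0≤sq (first Ψ (∁ p) us q)))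
            (square (first Φ p us y) (first Ψ (∁ p) us q)))
        where
        square : ∀ x z → x * x + z * z ≡ (x + z) * (x + z) - 1ℤ * (x * z + x * z)
        square = solve-∀
        xa : card p ℕ.+ suc a ≡ n
        xa = trans (trans (ℕₚ.+-suc (card p) a) (ℕₚ.+-comm 1 _)) xi
        wb : card (∁ p) ℕ.+ suc b ≡ n
        wb = trans (trans (ℕₚ.+-suc (card (∁ p)) b) (ℕₚ.+-comm 1 _)) wj
        hess≡ : ∀ us y q → let d = first Φ p us y * first Ψ (∁ p) us q in
          hess (paired n Φ Ψ) (states p) a b us y q ≡ d + d
        hess≡ us y q = trans (hess-paired n Φ Ψ p a b us y q) (trans
            (cong₂ _+_ (cong₂ _+_ (cong (_* g) (second-level-≢ Φ p (too-big 0 xa) us y))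
                                    (cong₂ (λ x z → x * z + x * z) (first-level-≡ Φ p xa us y) (first-level-≡ Ψ (∁ p) wb us q)))
                         (cong (f *_) (second-level-≢ Ψ (∁ p) (too-big 0 wb) us q)))
              (identity g f (d + d)))
          where
          d f g : ℤ
          f = level n Φ a p
          g = level n Ψ b (∁ p)
          d = first Φ p us y * first Ψ (∁ p) us q
          identity : ∀ g f D → 0ℤ * g + D + f * 0ℤ ≡ D
          identity = solve-∀
      by-codegree 2 _ refl xi wj = φ * ψ , 0<* (Φ.weight-pos p) (Ψ.weight-pos (∁ p)) , ψ ⊠ firstʸ Φ p , λ us y q →
        subst₂ _≤_ (trans (assoc φ ψ (second Φ p us y)) (cong (φ * ψ *_) (sym (hess≡ us y q))))
          (cong sq (trans (cong (ψ *_) (first≡⟦firstʸ⟧ Φ p us y q)) (sym (⟦⟧-⊠ ψ (firstʸ Φ p) us y q))))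
          (scaled us y)
        where
        φ ψ : ℤ
        φ = Φ p
        ψ = Ψ (∁ p)
        wb : card (∁ p) ℕ.+ b ≡ n
        wb = trans (sym (ℕₚ.+-identityʳ _)) wj
        xa : card p ℕ.+ suc (suc a) ≡ n
        xa = trans (rearrange (card p) a) xi
          where
          rearrange : ∀ w b → w ℕ.+ suc (suc b) ≡ w ℕ.+ b ℕ.+ 2
          rearrange = ℕ-Solver.solve-∀
        assoc : ∀ φ ψ Q → ψ * ψ * (φ * Q) ≡ φ * ψ * (Q * ψ)
        assoc = solve-∀
        scaled : ∀ us y → ψ * ψ * (φ * second Φ p us y) ≤ sq (ψ * first Φ p us y)
        scaled us y = by-difference (0≤* (0≤sq ψ) (difference (Φ.second≤first² p us y)))
          (identity ψ (φ * second Φ p us y) (first Φ p us y))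
          where
          identity : ∀ φ Q l → φ * φ * (l * l - Q) ≡ φ * l * (φ * l) - φ * φ * Q
          identity = solve-∀
        hess≡ : ∀ us y q → hess (paired n Φ Ψ) (states p) a b us y q ≡ second Φ p us y * ψ
        hess≡ us y q = trans (hess-paired n Φ Ψ p a b us y q) (trans
            (cong₂ _+_ (cong₂ _+_ (cong₂ _*_ (second-level-≡ Φ p xa us y) (level-≡ Ψ (∁ p) wb))
                                    (cong (λ z → l * z + l * z) (first-level-≢ Ψ (∁ p) (too-big 0 wb) us q)))
                         (cong (f *_) (second-level-≢ Ψ (∁ p) (too-big 1 wb) us q)))
              (identity f l (second Φ p us y * ψ)))
          where
          f l : ℤ
          f = level n Φ a p
          l = first-level n Φ a p us y
          identity : ∀ f l Q → Q + (l * 0ℤ + l * 0ℤ) + f * 0ℤ ≡ Q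
          identity = solve-∀
      by-codegree (suc (suc (suc _))) _ () _ _

    paired-good : Good n 0 (paired n Φ Ψ)
    paired-good = record
      { nonneg = λ σ a b → 0≤* (level-nonneg {n = n} {a} Φ (supportˣ σ) (<⇒≤ (Φ.weight-pos (supportˣ σ))))
                                (level-nonneg {n = n} {b} Ψ (supportʷ σ) (<⇒≤ (Ψ.weight-pos (supportʷ σ))))
      ; pos = λ σ a b x≤n w≤n total → let total′ = trans (sym (ℕₚ.+-identityʳ _)) total in
          paired-pos σ a b (saturated x≤n w≤n total′) (saturated w≤n x≤n (trans (ℕₚ.+-comm _ (degˣ σ ℕ.+ a)) total′))
      ; zeroˣ = paired-zeroˣ
      ; zeroʷ = paired-zeroʷ
      ; lorentzian = paired-lorentzian
      }
      where
      saturated : ∀ {x w} → x ℕ.≤ n → w ℕ.≤ n → x ℕ.+ w ≡ n ℕ.+ n → x ≡ n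
      saturated {x} {w} x≤n w≤n total = ℕₚ.≤-antisym x≤n
        (ℕₚ.+-cancelʳ-≤ n n x (subst (ℕ._≤ x ℕ.+ n) total (ℕₚ.+-monoʳ-≤ x w≤n)))

  -- Parallel classes

  sumOver : {A : Set} → List A → (A → ℤ) → ℤ
  sumOver []       f = 0ℤ
  sumOver (x ∷ xs) f = f x + sumOver xs f

  pairSum : {A : Set} → List A → (A → A → ℤ) → ℤ
  pairSum []       h = 0ℤ
  pairSum (x ∷ xs) h = sumOver xs (h x) + pairSum xs h

  module _ {A : Set} where

    sumOver-cong : ∀ {P : A → Set} {f g : A → ℤ} → (∀ {x} → P x → f x ≡ g x) → ∀ {xs} → All P xs → sumOver xs f ≡ sumOver xs g
    sumOver-cong f≡g []         = refl
    sumOver-cong f≡g (px ∷ pxs) = cong₂ _+_ (f≡g px) (sumOver-cong f≡g pxs)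

    pairSum-cong : ∀ {R : A → A → Set} {f g : A → A → ℤ} → (∀ {x y} → R x y → f x y ≡ g x y) →
      ∀ {xs} → AllPairs R xs → pairSum xs f ≡ pairSum xs g
    pairSum-cong f≡g []         = refl
    pairSum-cong f≡g (rx ∷ rxs) = cong₂ _+_ (sumOver-cong f≡g rx) (pairSum-cong f≡g rxs)

    sumOver-+ : ∀ (f g : A → ℤ) xs → sumOver xs (λ x → f x + g x) ≡ sumOver xs f + sumOver xs g
    sumOver-+ f g []       = refl
    sumOver-+ f g (x ∷ xs) = trans (cong (λ z → f x + g x + z) (sumOver-+ f g xs)) (identity (f x) (g x) (sumOver xs f) (sumOver xs g))
      where
      identity : ∀ a b c d → a + b + (c + d) ≡ a + c + (b + d)
      identity = solve-∀

    sumOver-* : ∀ k (f : A → ℤ) xs → sumOver xs (λ x → k * f x) ≡ k * sumOver xs f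
    sumOver-* k f []       = sym (*-zeroʳ k)
    sumOver-* k f (x ∷ xs) = trans (cong (λ z → k * f x + z) (sumOver-* k f xs)) (sym (*-distribˡ-+ k (f x) (sumOver xs f)))

    pairSum-+ : ∀ (f g : A → A → ℤ) xs → pairSum xs (λ x y → f x y + g x y) ≡ pairSum xs f + pairSum xs g
    pairSum-+ f g []       = refl
    pairSum-+ f g (x ∷ xs) = trans (cong₂ _+_ (sumOver-+ (f x) (g x) xs) (pairSum-+ f g xs))
      (identity (sumOver xs (f x)) (sumOver xs (g x)) (pairSum xs f) (pairSum xs g))
      where
      identity : ∀ a b c d → a + b + (c + d) ≡ a + c + (b + d)
      identity = solve-∀

    pairSum-* : ∀ k (f : A → A → ℤ) xs → pairSum xs (λ x y → k * f x y) ≡ k * pairSum xs f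
    pairSum-* k f []       = sym (*-zeroʳ k)
    pairSum-* k f (x ∷ xs) = trans (cong₂ _+_ (sumOver-* k (f x) xs) (pairSum-* k f xs))
      (sym (*-distribˡ-+ k (sumOver xs (f x)) (pairSum xs f)))

    0≤sumOver : ∀ (f : A → ℤ) → (∀ x → 0ℤ ≤ f x) → ∀ xs → 0ℤ ≤ sumOver xs f
    0≤sumOver f 0≤f []       = ≤-refl
    0≤sumOver f 0≤f (x ∷ xs) = 0≤+ (0≤f x) (0≤sumOver f 0≤f xs)

    square-sum : ∀ (w : A → ℤ) xs → let P = pairSum xs (λ x y → w x * w y) in
      sq (sumOver xs w) ≡ sumOver xs (sq ∘ w) + (P + P)
    square-sum w []       = refl
    square-sum w (x ∷ xs) = trans (expand (w x) (sumOver xs w))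
      (trans (cong₂ (λ s z → w x * w x + s + (z + z)) (square-sum w xs) (sym (sumOver-* (w x) w xs)))
             (identity (w x * w x) (sumOver xs (sq ∘ w)) (pairSum xs (λ x y → w x * w y)) (sumOver xs (λ y → w x * w y))))
      where
      expand : ∀ a s → (a + s) * (a + s) ≡ a * a + s * s + (a * s + a * s)
      expand = solve-∀
      identity : ∀ a q p z → a + (q + (p + p)) + (z + z) ≡ a + q + (z + p + (z + p))
      identity = solve-∀

    deviation : ∀ c (w : A → ℤ) xs →
      sumOver xs (λ x → sq (c - w x)) ≡ + length xs * sq c - (c + c) * sumOver xs w + sumOver xs (sq ∘ w)
    deviation c w []       = sym (identity c)
      where
      identity : ∀ c → 0ℤ * (c * c) - (c + c) * 0ℤ + 0ℤ ≡ 0ℤ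
      identity = solve-∀
    deviation c w (x ∷ xs) = trans (cong (λ z → sq (c - w x) + z) (deviation c w xs))
      (identity c (w x) (+ length xs) (sumOver xs w) (sumOver xs (sq ∘ w)))
      where
      identity : ∀ c x l s q → (c - x) * (c - x) + (l * (c * c) - (c + c) * s + q) ≡ (1ℤ + l) * (c * c) - (c + c) * (x + s) + (x * x + q)
      identity = solve-∀

    cauchy-schwarz : ∀ (w : A → ℤ) xs → sq (sumOver xs w) ≤ + length xs * sumOver xs (sq ∘ w)
    cauchy-schwarz w []       = ≤-refl
    cauchy-schwarz w (x ∷ xs) = by-difference
      (0≤+ (difference (cauchy-schwarz w xs)) (0≤sumOver (λ y → sq (w x - w y)) (λ y → 0≤sq (w x - w y)) xs))
      (trans (cong (λ z → + length xs * sumOver xs (sq ∘ w) - sq (sumOver xs w) + z) (deviation (w x) w xs))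
             (identity (w x) (+ length xs) (sumOver xs w) (sumOver xs (sq ∘ w))))
      where
      identity : ∀ c l s q → l * q - s * s + (l * (c * c) - (c + c) * s + q) ≡ (1ℤ + l) * (c * c + q) - (c + s) * (c + s)
      identity = solve-∀

  module Classes {A : Set} {_≈_ : Rel A 0ℓ} (isDecEquivalence : IsDecEquivalence _≈_) (w : A → ℤ) where

    open IsDecEquivalence isDecEquivalence using () renaming (_≟_ to _≈?_; sym to ≈-sym; trans to ≈-trans)

    χ : A → A → ℤ
    χ x y = if does (x ≈? y) then 1ℤ else 0ℤ

    χ-yes : ∀ {x y} → x ≈ y → χ x y ≡ 1ℤ
    χ-yes {x} {y} x≈y with x ≈? y
    ... | yes _  = refl
    ... | no x≉y = ⊥-elim (x≉y x≈y)

    χ-no : ∀ {x y} → ¬ x ≈ y → χ x y ≡ 0ℤ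
    χ-no {x} {y} x≉y with x ≈? y
    ... | yes x≈y = ⊥-elim (x≉y x≈y)
    ... | no _    = refl

    χ-respʳ : ∀ {x y} z → x ≈ y → χ z x ≡ χ z y
    χ-respʳ {x} {y} z x≈y with z ≈? x
    ... | yes z≈x = sym (χ-yes (≈-trans z≈x x≈y))
    ... | no  z≉x = sym (χ-no λ z≈y → z≉x (≈-trans z≈y (≈-sym x≈y)))

    Class : Set
    Class = A × ℤ

    _≉_ : Class → Class → Set
    (r , _) ≉ (s , _) = ¬ r ≈ s

    insert : A → ℤ → List Class → List Class
    insert x v []             = (x , v) ∷ []
    insert x v ((r , c) ∷ cs) with x ≈? r
    ... | yes _ = (r , c + v) ∷ cs
    ... | no  _ = (r , c) ∷ insert x v cs

    classes : List A → List Class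
    classes []       = []
    classes (x ∷ xs) = insert x (w x) (classes xs)

    length-insert : ∀ x v cs → length (insert x v cs) ℕ.≤ suc (length cs)
    length-insert x v []             = ℕₚ.≤-refl
    length-insert x v ((r , c) ∷ cs) with x ≈? r
    ... | yes _ = ℕₚ.n≤1+n _
    ... | no  _ = ℕ.s≤s (length-insert x v cs)

    length-classes : ∀ xs → length (classes xs) ℕ.≤ length xs
    length-classes []       = ℕ.z≤n
    length-classes (x ∷ xs) = ℕₚ.≤-trans (length-insert x (w x) (classes xs)) (ℕ.s≤s (length-classes xs))

    insert-≉ : ∀ {r c} x v {cs} → ¬ r ≈ x → All ((r , c) ≉_) cs → All ((r , c) ≉_) (insert x v cs)
    insert-≉ x v {[]}           r≉x []         = r≉x ∷ []
    insert-≉ {r} {c} x v {(s , d) ∷ cs} r≉x (r≉s ∷ ≉s) with x ≈? s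
    ... | yes _ = r≉s ∷ ≉s
    ... | no  _ = r≉s ∷ insert-≉ {r} {c} x v r≉x ≉s

    insert-distinct : ∀ x v {cs} → AllPairs _≉_ cs → AllPairs _≉_ (insert x v cs)
    insert-distinct x v {[]}           []         = [] ∷ []
    insert-distinct x v {(r , c) ∷ cs} (≉r ∷ ≉cs) with x ≈? r
    ... | yes _   = ≉r ∷ ≉cs
    ... | no  x≉r = insert-≉ {c = c} x v (λ r≈x → x≉r (≈-sym r≈x)) ≉r ∷ insert-distinct x v ≉cs

    classes-distinct : ∀ xs → AllPairs _≉_ (classes xs)
    classes-distinct []       = []
    classes-distinct (x ∷ xs) = insert-distinct x (w x) (classes-distinct xs)

    total-insert : ∀ x v cs → sumOver (insert x v cs) proj₂ ≡ v + sumOver cs proj₂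
    total-insert x v []             = refl
    total-insert x v ((r , c) ∷ cs) with x ≈? r
    ... | yes _ = identity v c (sumOver cs proj₂)
      where
      identity : ∀ v c s → c + v + s ≡ v + (c + s)
      identity = solve-∀
    ... | no  _ = trans (cong (λ z → c + z) (total-insert x v cs)) (identity v c (sumOver cs proj₂))
      where
      identity : ∀ v c s → c + (v + s) ≡ v + (c + s)
      identity = solve-∀

    total-classes : ∀ xs → sumOver (classes xs) proj₂ ≡ sumOver xs w
    total-classes []       = refl
    total-classes (x ∷ xs) = trans (total-insert x (w x) (classes xs)) (cong (λ z → w x + z) (total-classes xs))

    massAt : A → Class → ℤ
    massAt z (r , c) = χ z r * c

    massAt-insert : ∀ z x v cs → sumOver (insert x v cs) (massAt z) ≡ χ z x * v + sumOver cs (massAt z)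
    massAt-insert z x v []             = refl
    massAt-insert z x v ((r , c) ∷ cs) with x ≈? r
    ... | yes x≈r rewrite χ-respʳ z x≈r = identity (χ z r) v c (sumOver cs (massAt z))
      where
      identity : ∀ k v c s → k * (c + v) + s ≡ k * v + (k * c + s)
      identity = solve-∀
    ... | no  _ = trans (cong (λ s → χ z r * c + s) (massAt-insert z x v cs)) (identity (χ z x * v) (χ z r * c) (sumOver cs (massAt z)))
      where
      identity : ∀ v c s → c + (v + s) ≡ v + (c + s)
      identity = solve-∀

    massAt-classes : ∀ z xs → sumOver (classes xs) (massAt z) ≡ sumOver xs (λ y → χ z y * w y)
    massAt-classes z []       = refl
    massAt-classes z (x ∷ xs) =
      trans (massAt-insert z x (w x) (classes xs)) (cong (λ s → χ z x * w x + s) (massAt-classes z xs))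

    massAt-≉ : ∀ {x r c cs} → x ≈ r → All ((r , c) ≉_) cs → sumOver cs (massAt x) ≡ 0ℤ
    massAt-≉ x≈r []                     = refl
    massAt-≉ {c = c} x≈r (_∷_ {_ , d} r≉s ≉s) = cong₂ _+_
      (cong (_* d) (χ-no λ x≈s → r≉s (≈-trans (≈-sym x≈r) x≈s))) (massAt-≉ {c = c} x≈r ≉s)

    energy : List Class → ℤ
    energy cs = sumOver cs (sq ∘ proj₂)

    energy-insert : ∀ x v {cs} → AllPairs _≉_ cs → let a = v * sumOver cs (massAt x) in
      energy (insert x v cs) ≡ sq v + (a + a) + energy cs
    energy-insert x v {[]}           []         = identity v
      where
      identity : ∀ v → v * v + 0ℤ ≡ v * v + (v * 0ℤ + v * 0ℤ) + 0ℤ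
      identity = solve-∀
    energy-insert x v {(r , c) ∷ cs} (≉r ∷ ≉cs) with x ≈? r
    ... | yes x≈r rewrite massAt-≉ {c = c} x≈r ≉r = identity v c (energy cs)
      where
      identity : ∀ v c e → (c + v) * (c + v) + e ≡ v * v + (v * (1ℤ * c + 0ℤ) + v * (1ℤ * c + 0ℤ)) + (c * c + e)
      identity = solve-∀
    ... | no  x≉r = trans (cong (λ e → sq c + e) (energy-insert x v ≉cs)) (identity v c (sumOver cs (massAt x)) (energy cs))
      where
      identity : ∀ v c s e → c * c + (v * v + (v * s + v * s) + e) ≡ v * v + (v * (0ℤ * c + s) + v * (0ℤ * c + s)) + (c * c + e)
      identity = solve-∀

    kernel : List A → ℤ
    kernel xs = sumOver xs (sq ∘ w) + (R + R)
      where
      R : ℤ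
      R = pairSum xs (λ x y → χ x y * (w x * w y))

    energy-classes : ∀ xs → energy (classes xs) ≡ kernel xs
    energy-classes []       = refl
    energy-classes (x ∷ xs) = trans (energy-insert x (w x) (classes-distinct xs))
      (trans (cong₂ (λ s e → sq (w x) + (s + s) + e)
                (trans (cong (w x *_) (massAt-classes x xs)) (trans (sym (sumOver-* (w x) (λ y → χ x y * w y) xs))
                  (sumOver-cong {P = λ _ → A} (λ {y} _ → commute (w x) (χ x y) (w y)) (All.universal (λ y → y) xs))))
                (energy-classes xs))
        (identity (sq (w x)) (sumOver xs (λ y → χ x y * (w x * w y))) (sumOver xs (sq ∘ w)) (pairSum xs (λ x y → χ x y * (w x * w y)))))
      where
      commute : ∀ a k b → a * (k * b) ≡ k * (a * b)
      commute = solve-∀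
      identity : ∀ a s q r → a + (s + s) + (q + (r + r)) ≡ a + q + (s + r + (s + r))
      identity = solve-∀

    sum²≤kernel : ∀ xs → sq (sumOver xs w) ≤ + length xs * kernel xs
    sum²≤kernel xs = ≤-trans
      (subst₂ _≤_ (cong sq (total-classes xs)) (cong (+ length (classes xs) *_) (energy-classes xs))
        (cauchy-schwarz proj₂ (classes xs)))
      (by-difference (0≤* (difference (+≤+ (length-classes xs)))
                          (subst (0ℤ ≤_) (energy-classes xs) (0≤sumOver (sq ∘ proj₂) (λ c → 0≤sq (proj₂ c)) (classes xs))))
        (identity (+ length xs) (+ length (classes xs)) (kernel xs)))
      where
      identity : ∀ l k e → (l - k) * e ≡ l * e - k * e
      identity = solve-∀

  outsiders : ∀ {m} → Subset m → List (Fin m)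
  outsiders []          = []
  outsiders (true  ∷ p) = List.map suc (outsiders p)
  outsiders (false ∷ p) = zero ∷ List.map suc (outsiders p)

  _⊕_ : ∀ {m} → Subset m → Fin m → Subset m
  p ⊕ j = p [ j ]≔ inside

  Outside : ∀ {m} → Subset m → Fin m → Set
  Outside p j = lookup p j ≡ outside

  OutsidePair : ∀ {m} → Subset m → Fin m → Fin m → Set
  OutsidePair p j k = Outside p j × Outside p k × j ≢ k

  outsiders-outside : ∀ {m} (p : Subset m) → All (Outside p) (outsiders p)
  outsiders-outside []          = []
  outsiders-outside (true  ∷ p) = Allₚ.map⁺ (outsiders-outside p)
  outsiders-outside (false ∷ p) = refl ∷ Allₚ.map⁺ (outsiders-outside p)

  outsiders-pairs : ∀ {m} (p : Subset m) → AllPairs (OutsidePair p) (outsiders p)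
  outsiders-pairs []          = []
  outsiders-pairs (true  ∷ p) =
    AllPairsₚ.map⁺ (AllPairs.map (λ (oj , ok , j≢k) → oj , ok , λ e → j≢k (Finₚ.suc-injective e)) (outsiders-pairs p))
  outsiders-pairs (false ∷ p) =
    Allₚ.map⁺ (All.map (λ o → refl , o , λ ()) (outsiders-outside p)) ∷
    AllPairsₚ.map⁺ (AllPairs.map (λ (oj , ok , j≢k) → oj , ok , λ e → j≢k (Finₚ.suc-injective e)) (outsiders-pairs p))

  length-outsiders : ∀ {m} (p : Subset m) → length (outsiders p) ℕ.+ card p ≡ m
  length-outsiders []          = refl
  length-outsiders (true  ∷ p) = trans (cong (ℕ._+ suc (card p)) (Listₚ.length-map suc (outsiders p)))
    (trans (ℕₚ.+-suc _ (card p)) (cong suc (length-outsiders p)))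
  length-outsiders (false ∷ p) =
    cong suc (trans (cong (ℕ._+ card p) (Listₚ.length-map suc (outsiders p))) (length-outsiders p))

  card-⊕ : ∀ {m} (p : Subset m) {j} → Outside p j → card (p ⊕ j) ≡ suc (card p)
  card-⊕ (false ∷ p) {zero}  _ = refl
  card-⊕ (true  ∷ p) {suc j} o = cong suc (card-⊕ p o)
  card-⊕ (false ∷ p) {suc j} o = card-⊕ p o

  outside-⊕ : ∀ {m} (p : Subset m) {j k} → j ≢ k → Outside p j → Outside (p ⊕ k) j
  outside-⊕ p j≢k o = trans (Vecₚ.lookup∘update′ j≢k p inside) o

  ⊕-comm : ∀ {m} (p : Subset m) {j k} → j ≢ k → (p ⊕ j) ⊕ k ≡ (p ⊕ k) ⊕ j
  ⊕-comm p {j} {k} j≢k = Vecₚ.[]≔-commutes p j k j≢k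

  module _ {A C : Set} (s : A → C) where

    sumOver-map : ∀ (f : C → ℤ) xs → sumOver (List.map s xs) f ≡ sumOver xs (f ∘ s)
    sumOver-map f []       = refl
    sumOver-map f (x ∷ xs) = cong (λ z → f (s x) + z) (sumOver-map f xs)

    pairSum-map : ∀ (h : C → C → ℤ) xs → pairSum (List.map s xs) h ≡ pairSum xs (λ x y → h (s x) (s y))
    pairSum-map h []       = refl
    pairSum-map h (x ∷ xs) = cong₂ _+_ (sumOver-map (h (s x)) xs) (pairSum-map h xs)

  linₛ≡sumOver : ∀ {m} (Φ : Subset m → ℤ) p us →
    linₛ Φ p us ≡ sumOver (outsiders p) (λ j → lookup us j * Φ (p ⊕ j))
  linₛ≡sumOver Φ []          []       = refl
  linₛ≡sumOver Φ (true  ∷ p) (u ∷ us) =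
    trans (linₛ≡sumOver (λ q → Φ (inside ∷ q)) p us)
          (sym (sumOver-map suc (λ j → lookup (u ∷ us) j * Φ ((true ∷ p) ⊕ j)) (outsiders p)))
  linₛ≡sumOver Φ (false ∷ p) (u ∷ us) = cong (λ z → u * Φ (inside ∷ p) + z)
    (trans (linₛ≡sumOver (λ q → Φ (outside ∷ q)) p us)
           (sym (sumOver-map suc (λ j → lookup (u ∷ us) j * Φ ((false ∷ p) ⊕ j)) (outsiders p))))

  quadₛ≡pairSum : ∀ {m} (Φ : Subset m → ℤ) p us →
    let X = pairSum (outsiders p) (λ j k → lookup us j * lookup us k * Φ ((p ⊕ j) ⊕ k)) in
    quadₛ Φ p us ≡ X + X
  quadₛ≡pairSum Φ []          []       = refl
  quadₛ≡pairSum Φ (true  ∷ p) (u ∷ us) =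
    trans (quadₛ≡pairSum (λ q → Φ (inside ∷ q)) p us)
          (cong (λ z → z + z)
            (sym (pairSum-map suc (λ j k → lookup (u ∷ us) j * lookup (u ∷ us) k * Φ (((true ∷ p) ⊕ j) ⊕ k)) (outsiders p))))
  quadₛ≡pairSum Φ (false ∷ p) (u ∷ us) = trans
    (cong₂ (λ l z → (u + u) * l + z) (linₛ≡sumOver (λ q → Φ (inside ∷ q)) p us) (quadₛ≡pairSum (λ q → Φ (outside ∷ q)) p us))
    (trans (distribute u (sumOver (outsiders p) (λ k → lookup us k * Φ (inside ∷ (p ⊕ k)))) X)
      (cong (λ z → z + z) (cong₂ _+_
        (trans (sym (sumOver-* u (λ k → lookup us k * Φ (inside ∷ (p ⊕ k))) (outsiders p)))
          (trans (sumOver-cong {P = Outside p} (λ {k} _ → sym (*-assoc u (lookup us k) (Φ (inside ∷ (p ⊕ k))))) (outsiders-outside p))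
                 (sym (sumOver-map suc (λ k → u * lookup (u ∷ us) k * Φ (((false ∷ p) ⊕ zero) ⊕ k)) (outsiders p)))))
        (sym (pairSum-map suc (λ j k → lookup (u ∷ us) j * lookup (u ∷ us) k * Φ (((false ∷ p) ⊕ j) ⊕ k)) (outsiders p))))))
    where
    X : ℤ
    X = pairSum (outsiders p) (λ j k → lookup us j * lookup us k * Φ (outside ∷ ((p ⊕ j) ⊕ k)))
    distribute : ∀ u l x → (u + u) * l + (x + x) ≡ u * l + x + (u * l + x)
    distribute = solve-∀

  record RankLike {m} (g : Subset m → ℕ) : Set where
    field
      monotone   : ∀ p {j} → Outside p j → g p ℕ.≤ g (p ⊕ j)
      unit       : ∀ p {j} → Outside p j → g (p ⊕ j) ℕ.≤ suc (g p)
      submodular : ∀ p {j k} → OutsidePair p j k → g p ℕ.+ g ((p ⊕ j) ⊕ k) ℕ.≤ g (p ⊕ j) ℕ.+ g (p ⊕ k)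

  pairSum-short : ∀ {A : Set} (xs : List A) (h : A → A → ℤ) → length xs ℕ.≤ 1 → pairSum xs h ≡ 0ℤ
  pairSum-short []          h _ = refl
  pairSum-short (x ∷ [])    h _ = refl
  pairSum-short (x ∷ _ ∷ _) h (ℕ.s≤s ())

  module Weights {m : ℕ} {g : Subset m → ℕ} (rankLike : RankLike g) (t : ℕ) where

    open RankLike rankLike

    N : ℤ
    N = + suc t

    pow : ℕ → ℤ
    pow e = + (suc t ℕ.^ e)

    pow-+ : ∀ a b → pow (a ℕ.+ b) ≡ pow a * pow b
    pow-+ a b = trans (cong +_ (ℕₚ.^-distribˡ-+-* (suc t) a b)) (pos-* (suc t ℕ.^ a) (suc t ℕ.^ b))

    pow-suc : ∀ a → pow (suc a) ≡ N * pow a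
    pow-suc a = pos-* (suc t) (suc t ℕ.^ a)

    0<pow : ∀ a → 0ℤ < pow a
    0<pow a = +<+ (ℕₚ.m^n>0 (suc t) a)

    weight : Subset m → ℤ
    weight p = + ((m ℕ.∸ card p) !) * pow (g p)

    weight-at : ∀ {l} q → l ℕ.+ card q ≡ m → weight q ≡ + (l !) * pow (g q)
    weight-at {l} q eq = cong (λ k → + (k !) * pow (g q)) (trans (cong (ℕ._∸ card q) (sym eq)) (ℕₚ.m+n∸n≡m l (card q)))

    module _ (p : Subset m) where

      Parallel : Rel (Fin m) 0ℓ
      Parallel j k = Outside p j × Outside p k × g p ℕ.+ g ((p ⊕ j) ⊕ k) ℕ.< g (p ⊕ j) ℕ.+ g (p ⊕ k)

      _≈_ : Rel (Fin m) 0ℓ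
      j ≈ k = j ≡ k ⊎ Parallel j k

      ≈-sym : ∀ {j k} → j ≈ k → k ≈ j
      ≈-sym         (inj₁ j≡k) = inj₁ (sym j≡k)
      ≈-sym {j} {k} (inj₂ (oj , ok , par)) with j Finₚ.≟ k
      ... | yes j≡k = inj₁ (sym j≡k)
      ... | no  j≢k = inj₂ (ok , oj , subst₂ ℕ._<_ (cong (λ q → g p ℕ.+ g q) (⊕-comm p j≢k)) (ℕₚ.+-comm (g (p ⊕ j)) _) par)

      -- Submodularity at p + k, with the value at p + j + k + l bounded below by the one at p + j + l.
      parallel-trans : ∀ {j k l} → j ≢ k → k ≢ l → j ≢ l → Parallel j k → Parallel k l → Parallel j l
      parallel-trans {j} {k} {l} j≢k k≢l j≢l (oj , ok , jk) (_ , ol , kl) = oj , ol ,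
        ℕₚ.+-cancelʳ-≤ (Ak ℕ.+ (suc h ℕ.+ Ak)) _ _ (begin
          suc (h ℕ.+ Bjl) ℕ.+ (Ak ℕ.+ (suc h ℕ.+ Ak))       ≡⟨ rearrange₁ h Bjl Ak ⟩
          Ak ℕ.+ Bjl ℕ.+ (suc h ℕ.+ suc h ℕ.+ Ak)           ≤⟨ ℕₚ.+-monoˡ-≤ _ exchange ⟩
          Bjk ℕ.+ Bkl ℕ.+ (suc h ℕ.+ suc h ℕ.+ Ak)          ≡⟨ rearrange₂ h Bjk Bkl Ak ⟩
          suc (h ℕ.+ Bjk) ℕ.+ suc (h ℕ.+ Bkl) ℕ.+ Ak        ≤⟨ ℕₚ.+-mono-≤ (ℕₚ.+-mono-≤ jk kl) (unit p ok) ⟩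
          Aj ℕ.+ Ak ℕ.+ (Ak ℕ.+ Al) ℕ.+ suc h               ≡⟨ rearrange₃ Aj Ak Al (suc h) ⟩
          Aj ℕ.+ Al ℕ.+ (Ak ℕ.+ (suc h ℕ.+ Ak))             ∎)
        where
        open ℕₚ.≤-Reasoning
        h Aj Ak Al Bjk Bkl Bjl : ℕ
        h   = g p
        Aj  = g (p ⊕ j)
        Ak  = g (p ⊕ k)
        Al  = g (p ⊕ l)
        Bjk = g ((p ⊕ j) ⊕ k)
        Bkl = g ((p ⊕ k) ⊕ l)
        Bjl = g ((p ⊕ j) ⊕ l)
        C≡ : ((p ⊕ j) ⊕ l) ⊕ k ≡ ((p ⊕ k) ⊕ j) ⊕ l
        C≡ = trans (⊕-comm (p ⊕ j) (k≢l ∘ sym)) (cong (_⊕ l) (⊕-comm p j≢k))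
        exchange : Ak ℕ.+ Bjl ℕ.≤ Bjk ℕ.+ Bkl
        exchange = begin
          Ak ℕ.+ Bjl                         ≤⟨ ℕₚ.+-monoʳ-≤ Ak (monotone ((p ⊕ j) ⊕ l)
                                                  (outside-⊕ (p ⊕ j) k≢l (outside-⊕ p (j≢k ∘ sym) ok))) ⟩
          Ak ℕ.+ g (((p ⊕ j) ⊕ l) ⊕ k)       ≡⟨ cong (λ q → Ak ℕ.+ g q) C≡ ⟩
          Ak ℕ.+ g (((p ⊕ k) ⊕ j) ⊕ l)       ≤⟨ submodular (p ⊕ k) (outside-⊕ p j≢k oj , outside-⊕ p (k≢l ∘ sym) ol , j≢l) ⟩
          g ((p ⊕ k) ⊕ j) ℕ.+ Bkl            ≡⟨ cong (λ q → g q ℕ.+ Bkl) (⊕-comm p j≢k) ⟨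
          Bjk ℕ.+ Bkl                        ∎
        rearrange₁ : ∀ h b a → suc (h ℕ.+ b) ℕ.+ (a ℕ.+ (suc h ℕ.+ a)) ≡ a ℕ.+ b ℕ.+ (suc h ℕ.+ suc h ℕ.+ a)
        rearrange₁ = ℕ-Solver.solve-∀
        rearrange₂ : ∀ h b c a → b ℕ.+ c ℕ.+ (suc h ℕ.+ suc h ℕ.+ a) ≡ suc (h ℕ.+ b) ℕ.+ suc (h ℕ.+ c) ℕ.+ a
        rearrange₂ = ℕ-Solver.solve-∀
        rearrange₃ : ∀ a b c h → a ℕ.+ b ℕ.+ (b ℕ.+ c) ℕ.+ h ≡ a ℕ.+ c ℕ.+ (b ℕ.+ (h ℕ.+ b))
        rearrange₃ = ℕ-Solver.solve-∀

      ≈-trans : ∀ {j k l} → j ≈ k → k ≈ l → j ≈ l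
      ≈-trans (inj₁ refl) k≈l         = k≈l
      ≈-trans j≈k         (inj₁ refl) = j≈k
      ≈-trans {j} {k} {l} (inj₂ jk) (inj₂ kl) with j Finₚ.≟ k | k Finₚ.≟ l | j Finₚ.≟ l
      ... | yes refl | _        | _       = inj₂ kl
      ... | _        | yes refl | _       = inj₂ jk
      ... | _        | _        | yes j≡l = inj₁ j≡l
      ... | no j≢k   | no k≢l   | no j≢l  = inj₂ (parallel-trans j≢k k≢l j≢l jk kl)

      _≈?_ : Decidable _≈_
      j ≈? k = (j Finₚ.≟ k) ⊎-dec ((lookup p j Boolₚ.≟ outside) ×-dec (lookup p k Boolₚ.≟ outside) ×-dec
        (g p ℕ.+ g ((p ⊕ j) ⊕ k) ℕₚ.<? g (p ⊕ j) ℕ.+ g (p ⊕ k)))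

      ≈-isDecEquivalence : IsDecEquivalence _≈_
      ≈-isDecEquivalence = record
        { isEquivalence = record { refl = inj₁ refl ; sym = ≈-sym ; trans = ≈-trans }
        ; _≟_ = _≈?_
        }

      module _ (us : Vec ℤ m) where

        w : Fin m → ℤ
        w j = pow (g (p ⊕ j)) * lookup us j

        open Classes ≈-isDecEquivalence w

        pair-weight : ∀ {j k} → OutsidePair p j k →
          N * pow (g p) * (lookup us j * lookup us k * pow (g ((p ⊕ j) ⊕ k))) ≡
          N * (w j * w k) + (1ℤ - N) * (χ j k * (w j * w k))
        pair-weight {j} {k} (oj , ok , j≢k) =
          trans (regroup N (pow (g p)) (lookup us j) (lookup us k) (pow (g ((p ⊕ j) ⊕ k)))) (by-relation (j ≈? k))
          where
          uu v : ℤ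
          uu = lookup us j * lookup us k
          v = w j * w k
          regroup : ∀ n h u v b → n * h * (u * v * b) ≡ u * v * (n * (h * b))
          regroup = solve-∀
          by-relation : Dec (j ≈ k) →
            uu * (N * (pow (g p) * pow (g ((p ⊕ j) ⊕ k)))) ≡ N * v + (1ℤ - N) * (χ j k * v)
          by-relation (yes (inj₁ j≡k)) = ⊥-elim (j≢k j≡k)
          by-relation (yes (inj₂ (_ , _ , par))) =
            trans (cong (uu *_) powers)
              (trans (identity N (lookup us j) (lookup us k) (pow (g (p ⊕ j))) (pow (g (p ⊕ k))))
                     (cong (λ c → N * v + (1ℤ - N) * (c * v)) (sym (χ-yes (inj₂ (oj , ok , par))))))
            where
            exponents : suc (g p ℕ.+ g ((p ⊕ j) ⊕ k)) ≡ g (p ⊕ j) ℕ.+ g (p ⊕ k)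
            exponents = ℕₚ.≤-antisym par (ℕₚ.≤-trans
              (ℕₚ.+-mono-≤ (monotone (p ⊕ j) (outside-⊕ p (j≢k ∘ sym) ok)) (unit p ok))
              (ℕₚ.≤-reflexive (trans (ℕₚ.+-suc _ (g p)) (cong suc (ℕₚ.+-comm _ (g p))))))
            powers : N * (pow (g p) * pow (g ((p ⊕ j) ⊕ k))) ≡ pow (g (p ⊕ j)) * pow (g (p ⊕ k))
            powers = trans (cong (N *_) (sym (pow-+ (g p) (g ((p ⊕ j) ⊕ k)))))
              (trans (sym (pow-suc (g p ℕ.+ g ((p ⊕ j) ⊕ k)))) (trans (cong pow exponents) (pow-+ (g (p ⊕ j)) (g (p ⊕ k)))))
            identity : ∀ n u v a b → u * v * (a * b) ≡ n * (a * u * (b * v)) + (1ℤ - n) * (1ℤ * (a * u * (b * v)))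
            identity = solve-∀
          by-relation (no j≉k) =
            trans (cong (λ z → uu * (N * z)) powers)
              (trans (identity N (lookup us j) (lookup us k) (pow (g (p ⊕ j))) (pow (g (p ⊕ k))))
                     (cong (λ c → N * v + (1ℤ - N) * (c * v)) (sym (χ-no j≉k))))
            where
            exponents : g p ℕ.+ g ((p ⊕ j) ⊕ k) ≡ g (p ⊕ j) ℕ.+ g (p ⊕ k)
            exponents = ℕₚ.≤-antisym (submodular p (oj , ok , j≢k)) (ℕₚ.≮⇒≥ λ par → j≉k (inj₂ (oj , ok , par)))
            powers : pow (g p) * pow (g ((p ⊕ j) ⊕ k)) ≡ pow (g (p ⊕ j)) * pow (g (p ⊕ k))
            powers = trans (sym (pow-+ (g p) (g ((p ⊕ j) ⊕ k)))) (trans (cong pow exponents) (pow-+ (g (p ⊕ j)) (g (p ⊕ k))))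
            identity : ∀ n u v a b → u * v * (n * (a * b)) ≡ n * (a * u * (b * v)) + (1ℤ - n) * (0ℤ * (a * u * (b * v)))
            identity = solve-∀

        private
          xs : List (Fin m)
          xs = outsiders p
          Σw Q P R X : ℤ
          Σw = sumOver xs w
          Q = sumOver xs (sq ∘ w)
          P = pairSum xs (λ j k → w j * w k)
          R = pairSum xs (λ j k → χ j k * (w j * w k))
          X = pairSum xs (λ j k → lookup us j * lookup us k * pow (g ((p ⊕ j) ⊕ k)))

        scaled-pairs : N * pow (g p) * X ≡ N * P + (1ℤ - N) * R
        scaled-pairs = trans (sym (pairSum-* (N * pow (g p)) _ xs))
          (trans (pairSum-cong pair-weight (outsiders-pairs p))
            (trans (pairSum-+ (λ j k → N * (w j * w k)) (λ j k → (1ℤ - N) * (χ j k * (w j * w k))) xs)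
              (cong₂ _+_ (pairSum-* N (λ j k → w j * w k) xs) (pairSum-* (1ℤ - N) (λ j k → χ j k * (w j * w k)) xs))))

        linₛ-weight : ∀ {l} → length xs ≡ suc l → linₛ weight p us ≡ + (l !) * Σw
        linₛ-weight {l} len = trans (linₛ≡sumOver weight p us)
          (trans (sumOver-cong (λ {j} oj → trans (cong (lookup us j *_) (weight-at (p ⊕ j)
                      (trans (cong (l ℕ.+_) (card-⊕ p oj)) (trans (ℕₚ.+-suc l (card p))
                        (trans (cong (ℕ._+ card p) (sym len)) (length-outsiders p))))))
                    (commute (lookup us j) (+ (l !)) (pow (g (p ⊕ j))))) (outsiders-outside p))
            (sumOver-* (+ (l !)) w xs))
          where
          commute : ∀ u f a → u * (f * a) ≡ f * (a * u)
          commute = solve-∀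

        quadₛ-weight : ∀ {l} → length xs ≡ suc (suc l) → quadₛ weight p us ≡ + (l !) * X + + (l !) * X
        quadₛ-weight {l} len = trans (quadₛ≡pairSum weight p us) (cong (λ z → z + z)
          (trans (pairSum-cong (λ {j} {k} (oj , ok , j≢k) → trans (cong (lookup us j * lookup us k *_) (weight-at ((p ⊕ j) ⊕ k)
                      (trans (cong (l ℕ.+_) (trans (card-⊕ (p ⊕ j) (outside-⊕ p (j≢k ∘ sym) ok)) (cong suc (card-⊕ p oj))))
                        (trans (shift l (card p)) (trans (cong (ℕ._+ card p) (sym len)) (length-outsiders p))))))
                    (commute (lookup us j * lookup us k) (+ (l !)) (pow (g ((p ⊕ j) ⊕ k))))) (outsiders-pairs p))
            (pairSum-* (+ (l !)) _ xs)))
          where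
          commute : ∀ u f a → u * (f * a) ≡ f * (u * a)
          commute = solve-∀
          shift : ∀ l c → l ℕ.+ suc (suc c) ≡ suc (suc l) ℕ.+ c
          shift = ℕ-Solver.solve-∀

        log-concave-short : length xs ℕ.≤ 1 → weight p * quadₛ weight p us ≤ sq (linₛ weight p us)
        log-concave-short short = subst (_≤ sq (linₛ weight p us)) (sym (trans (cong (weight p *_)
            (trans (quadₛ≡pairSum weight p us) (cong (λ z → z + z) (pairSum-short xs _ short)))) (*-zeroʳ (weight p))))
          (0≤sq (linₛ weight p us))

        log-concave-long : ∀ {l} → length xs ≡ suc (suc l) → weight p * quadₛ weight p us ≤ sq (linₛ weight p us)
        log-concave-long {l} len = subst₂ _≤_
          (cong₂ _*_ (sym (weight-at p (trans (cong (ℕ._+ card p) (sym len)) (length-outsiders p)))) (sym (quadₛ-weight len)))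
          (cong sq (sym (linₛ-weight len)))
          (cancel-pos {N} (+<+ ℕ.z<s) (by-difference
            (0≤* (0≤* {f₁} {f₂} (+≤+ ℕ.z≤n) (+≤+ ℕ.z≤n))
              (0≤+ (difference (cauchy-schwarz w xs)) (0≤* {+ t} (+≤+ ℕ.z≤n) (difference (sum²≤kernel xs)))))
            computation))
          where
          f₁ f₂ M h : ℤ
          f₁ = + (suc l !)
          f₂ = + (l !)
          M = + length xs
          h = pow (g p)
          f₀≡ : + (suc (suc l) !) ≡ M * f₁
          f₀≡ = trans (pos-* (suc (suc l)) (suc l !)) (cong (λ k → + k * f₁) (sym len))
          f₁≡ : f₁ ≡ (M - 1ℤ) * f₂
          f₁≡ = trans (pos-* (suc l) (l !)) (cong (λ k → (+ k - 1ℤ) * f₂) (sym len))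
          identity : ∀ M t f₂ Q P R →
            (M - 1ℤ) * f₂ * f₂ * (M * Q - (Q + (P + P)) + t * (M * (Q + (R + R)) - (Q + (P + P)))) ≡
            (1ℤ + t) * ((M - 1ℤ) * f₂ * ((M - 1ℤ) * f₂) * (Q + (P + P)))
              - M * ((M - 1ℤ) * f₂) * f₂ * (((1ℤ + t) * P + (1ℤ - (1ℤ + t)) * R) + ((1ℤ + t) * P + (1ℤ - (1ℤ + t)) * R))
          identity = solve-∀
          goal : ℤ → Set
          goal f = f * f₂ * (M * Q - (Q + (P + P)) + + t * (M * (Q + (R + R)) - (Q + (P + P)))) ≡
            N * (f * f * (Q + (P + P))) - M * f * f₂ * ((N * P + (1ℤ - N) * R) + (N * P + (1ℤ - N) * R))
          computation : f₁ * f₂ * (M * Q - sq Σw + + t * (M * kernel xs - sq Σw)) ≡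
            N * sq (f₁ * Σw) - N * (+ (suc (suc l) !) * h * (f₂ * X + f₂ * X))
          computation = begin
            f₁ * f₂ * (M * Q - sq Σw + + t * (M * kernel xs - sq Σw))
              ≡⟨ cong (λ s → f₁ * f₂ * (M * Q - s + + t * (M * kernel xs - s))) (square-sum w xs) ⟩
            f₁ * f₂ * (M * Q - (Q + (P + P)) + + t * (M * (Q + (R + R)) - (Q + (P + P))))
              ≡⟨ subst goal (sym f₁≡) (identity M (+ t) f₂ Q P R) ⟩
            N * (f₁ * f₁ * (Q + (P + P))) - M * f₁ * f₂ * ((N * P + (1ℤ - N) * R) + (N * P + (1ℤ - N) * R))
              ≡⟨ cong₂ (λ s z → N * (f₁ * f₁ * s) - M * f₁ * f₂ * (z + z)) (square-sum w xs) scaled-pairs ⟨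
            N * (f₁ * f₁ * sq Σw) - M * f₁ * f₂ * (N * h * X + N * h * X)
              ≡⟨ regroup N f₁ Σw M f₂ h X ⟩
            N * sq (f₁ * Σw) - N * (M * f₁ * h * (f₂ * X + f₂ * X))
              ≡⟨ cong (λ f → N * sq (f₁ * Σw) - N * (f * h * (f₂ * X + f₂ * X))) f₀≡ ⟨
            N * sq (f₁ * Σw) - N * (+ (suc (suc l) !) * h * (f₂ * X + f₂ * X)) ∎
            where
            open ≡-Reasoning
            regroup : ∀ N f s M f₂ h X →
              N * (f * f * (s * s)) - M * f * f₂ * (N * h * X + N * h * X) ≡
              N * (f * s * (f * s)) - N * (M * f * h * (f₂ * X + f₂ * X))
            regroup = solve-∀

    weight-log-concave : LogConcaveWeight weight
    weight-log-concave = record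
      { weight-pos  = λ p → 0<* {+ ((m ℕ.∸ card p) !)} (+<+ (ℕₚ.1≤n! (m ℕ.∸ card p))) (0<pow (g p))
      ; quadₛ≤linₛ² = λ p us → by-length p us (length (outsiders p)) refl
      }
      where
      by-length : ∀ p us l → length (outsiders p) ≡ l → weight p * quadₛ weight p us ≤ sq (linₛ weight p us)
      by-length p us 0             len = log-concave-short p us (ℕₚ.≤-trans (ℕₚ.≤-reflexive len) ℕ.z≤n)
      by-length p us 1             len = log-concave-short p us (ℕₚ.≤-reflexive len)
      by-length p us (suc (suc l)) len = log-concave-long p us len

module CommonIndependentSets where

  open import Data.Bool.Base using (true; false; not)
  import Data.Bool.Properties as Boolₚ
  open import Data.Empty using (⊥-elim)
  open import Data.Fin.Base using (zero; suc)
  import Data.Fin.Properties as Finₚ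
  open import Data.Fin.Subset using (Subset; inside; outside; ∁; _∈_; _∉_; _⊆_; _∪_; ⁅_⁆; ⊥) renaming (∣_∣ to card)
  open import Data.Fin.Subset.Properties
    using (_∈?_; _⊆?_; ⊆-refl; ⊆-trans; p⊆p∪q; q⊆p∪q; x∈p∪q⁻; x∈⁅x⁆; x∈⁅y⁆⇒x≡y; p⊆q⇒∣p∣≤∣q∣; ⊥⊆; ∪-identityʳ; ∣∁p∣≡n∸∣p∣)
  open import Data.Integer.Base as ℤ using (ℤ; +_; 0ℤ)
  import Data.Integer.Properties as ℤₚ
  import Data.Integer.Tactic.RingSolver as ℤ-Solver
  open import Data.List.Base using (List; []; _∷_; filter; length; map; _++_)
  open import Data.List.Membership.Propositional.Properties using (∈-filter⁺)
  import Data.List.Relation.Unary.All as All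
  import Data.List.Relation.Unary.All.Properties as Allₚ
  open import Data.Nat.Base
  open import Data.Nat.Combinatorics using (_C_; nCk≡n!/k![n-k]!; k![n∸k]!∣n!)
  open import Data.Nat.DivMod using (m/n*n≡m)
  open import Data.Nat.ListAction using (sum)
  open import Data.Nat.Properties
  open import Data.Nat.Tactic.RingSolver using (solve-∀)
  open import Data.List.Extrema ≤-totalOrder using (argmax; argmax-all; f[xs]≤f[argmax])
  open import Data.Product.Base using (∃; _×_; _,_; proj₁; proj₂)
  import Data.Rational.Base as ℚ
  import Data.Rational.Properties as ℚₚ
  open import Data.Rational.Unnormalised.Base as ℚᵘ using (mkℚᵘ; *≤*)
  import Data.Rational.Unnormalised.Properties as ℚᵘₚ
  open import Data.Sum.Base using (inj₁; inj₂; [_,_]′)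
  open import Data.Vec.Base using ([]; _∷_)
  import Data.Vec.Properties as Vecₚ
  open import Function.Base using (_∘_)
  open import Level using (0ℓ)
  open import Relation.Binary.PropositionalEquality
  open import Relation.Nullary using (yes; no; ¬_)
  open import Relation.Nullary.Decidable using (_×-dec_)
  open import Relation.Unary using (Pred; Decidable)
  open WeightedForms

  -- Rank functions

  ⊕≡∪ : ∀ {m} (p : Subset m) j → p ⊕ j ≡ p ∪ ⁅ j ⁆
  ⊕≡∪ (b ∷ p) zero    = cong₂ _∷_ (sym (Boolₚ.∨-zeroʳ b)) (sym (∪-identityʳ p))
  ⊕≡∪ (b ∷ p) (suc j) = cong₂ _∷_ (sym (Boolₚ.∨-identityʳ b)) (⊕≡∪ p j)

  ∉⇒outside : ∀ {m} {p : Subset m} {j} → j ∉ p → Outside p j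
  ∉⇒outside {p = p} {j} j∉p = Boolₚ.¬-not (j∉p ∘ Vecₚ.lookup⇒[]= j p)

  outside⇒∉ : ∀ {m} {p : Subset m} {j} → Outside p j → j ∉ p
  outside⇒∉ o j∈p with trans (sym (Vecₚ.[]=⇒lookup j∈p)) o
  ... | ()

  card-∪-⁅⁆ : ∀ {m} {p : Subset m} {j} → j ∉ p → card (p ∪ ⁅ j ⁆) ≡ suc (card p)
  card-∪-⁅⁆ {p = p} {j} j∉p = trans (cong card (sym (⊕≡∪ p j))) (card-⊕ p (∉⇒outside j∉p))

  ⊆⊕ : ∀ {m} (p : Subset m) j → p ⊆ p ⊕ j
  ⊆⊕ p j = subst (p ⊆_) (sym (⊕≡∪ p j)) (p⊆p∪q ⁅ j ⁆)

  ∈⊕ : ∀ {m} (p : Subset m) j → j ∈ p ⊕ j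
  ∈⊕ p j = Vecₚ.[]≔-updates p j

  ∈⊕⁻ : ∀ {m} (p : Subset m) {j x} → x ∈ p ⊕ j → x ≢ j → x ∈ p
  ∈⊕⁻ p {j} x∈ x≢j with x∈p∪q⁻ p ⁅ j ⁆ (subst (_ ∈_) (⊕≡∪ p j) x∈)
  ... | inj₁ x∈p = x∈p
  ... | inj₂ x∈j = ⊥-elim (x≢j (x∈⁅y⁆⇒x≡y j x∈j))

  ∪-⁅⁆-⊆ : ∀ {m} {p q : Subset m} {x} → p ⊆ q → x ∈ q → p ∪ ⁅ x ⁆ ⊆ q
  ∪-⁅⁆-⊆ {p = p} {q} {x} p⊆q x∈q y∈ = [ p⊆q , (λ y∈x → subst (_∈ q) (sym (x∈⁅y⁆⇒x≡y x y∈x)) x∈q) ]′ (x∈p∪q⁻ p ⁅ x ⁆ y∈)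

  ∪-⁅⁆-mono : ∀ {m} {p q : Subset m} {x} → p ⊆ q → p ∪ ⁅ x ⁆ ⊆ q ∪ ⁅ x ⁆
  ∪-⁅⁆-mono {q = q} {x} p⊆q = ∪-⁅⁆-⊆ (⊆-trans p⊆q (p⊆p∪q ⁅ x ⁆)) (q⊆p∪q q ⁅ x ⁆ (x∈⁅x⁆ x))

  ⊆∧card≥⇒⊇ : ∀ {m} {p q : Subset m} → p ⊆ q → card q ≤ card p → q ⊆ p
  ⊆∧card≥⇒⊇ {p = p} {q} p⊆q q≤p {x} x∈q with x ∈? p
  ... | yes x∈p = x∈p
  ... | no  x∉p = ⊥-elim (<⇒≱ (≤-trans (≤-reflexive (sym (card-∪-⁅⁆ x∉p))) (p⊆q⇒∣p∣≤∣q∣ (∪-⁅⁆-⊆ p⊆q x∈q))) q≤p)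

  module Rank {n : ℕ} (M : Matroid n) where

    open Matroid M

    independents : Subset n → List (Subset n)
    independents p = filter (λ I → independent? I ×-dec I ⊆? p) (subsets n)

    basis : Subset n → Subset n
    basis p = argmax card ⊥ (independents p)

    rank : Subset n → ℕ
    rank p = card (basis p)

    basis-spec : ∀ p → Independent (basis p) × basis p ⊆ p
    basis-spec p = argmax-all card {P = λ I → Independent I × I ⊆ p} (empty , λ x∈ → ⊥⊆ x∈) (Allₚ.all-filter (λ I → independent? I ×-dec I ⊆? p) (subsets n))

    rank-max : ∀ {I p} → Independent I → I ⊆ p → card I ≤ rank p
    rank-max {I} {p} ind I⊆p = All.lookup (f[xs]≤f[argmax] ⊥ (independents p))
      (∈-filter⁺ (λ I → independent? I ×-dec I ⊆? p) (∈-subsets I) (ind , I⊆p))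

    augment : ∀ {I p} → Independent I → card I < rank p → ∃ λ x → x ∈ p × x ∉ I × Independent (I ∪ ⁅ x ⁆)
    augment {I} {p} ind I<r with augmentation ind (proj₁ (basis-spec p)) I<r
    ... | x , x∈ , x∉I , ind′ = x , proj₂ (basis-spec p) x∈ , x∉I , ind′

    extend : ∀ {I p} → Independent I → I ⊆ p → ∃ λ J → Independent J × I ⊆ J × J ⊆ p × card J ≡ rank p
    extend {I} {p} ind I⊆p with m≤n⇒∃[o]m+o≡n (rank-max ind I⊆p)
    ... | d , eq = go d ind I⊆p eq
      where
      go : ∀ d {I} → Independent I → I ⊆ p → card I + d ≡ rank p → ∃ λ J → Independent J × I ⊆ J × J ⊆ p × card J ≡ rank p
      go zero    {I} ind I⊆p eq = I , ind , ⊆-refl , I⊆p , trans (sym (+-identityʳ (card I))) eq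
      go (suc d) {I} ind I⊆p eq with augment {I} {p} ind (≤-trans (s≤s (m≤m+n (card I) d)) (≤-reflexive (trans (sym (+-suc (card I) d)) eq)))
      ... | x , x∈p , x∉I , ind′ with go d ind′ (∪-⁅⁆-⊆ I⊆p x∈p)
                                      (trans (cong (_+ d) (card-∪-⁅⁆ x∉I)) (trans (sym (+-suc (card I) d)) eq))
      ... | J , indJ , I∪x⊆J , rest = J , indJ , ⊆-trans (p⊆p∪q ⁅ x ⁆) I∪x⊆J , rest

    rank-mono : ∀ {p q} → p ⊆ q → rank p ≤ rank q
    rank-mono {p} p⊆q = rank-max (proj₁ (basis-spec p)) (⊆-trans (proj₂ (basis-spec p)) p⊆q)

    no-larger : ∀ {J p x} → card J ≡ rank p → J ⊆ p → x ∈ p → x ∉ J → ¬ Independent (J ∪ ⁅ x ⁆)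
    no-larger {J} {p} {x} J≡r J⊆p x∈p x∉J ind = <⇒≱ (≤-reflexive (cong suc (sym J≡r)))
      (≤-trans (≤-reflexive (sym (card-∪-⁅⁆ x∉J))) (rank-max ind (∪-⁅⁆-⊆ J⊆p x∈p)))

    rank-unit : ∀ p {j} → Outside p j → rank (p ⊕ j) ≤ suc (rank p)
    rank-unit p {j} oj with rank (p ⊕ j) ≤? suc (rank p)
    ... | yes r≤ = r≤
    ... | no  r≰ with augment {basis p} {p ⊕ j} (proj₁ (basis-spec p)) (≤-trans (n≤1+n _) (≰⇒> r≰))
    ... | x , x∈ , x∉I , ind with x Finₚ.≟ j
    ... | no x≢j = ⊥-elim (no-larger {p = p} refl (proj₂ (basis-spec p)) (∈⊕⁻ p x∈ x≢j) x∉I ind)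
    ... | yes refl with augment {basis p ∪ ⁅ j ⁆} {p ⊕ j} ind (subst (_< rank (p ⊕ j)) (sym (card-∪-⁅⁆ x∉I)) (≰⇒> r≰))
    ... | y , y∈ , y∉Ij , ind′ = ⊥-elim (no-larger {p = p} refl (proj₂ (basis-spec p)) (∈⊕⁻ p y∈ y≢j)
            (y∉Ij ∘ p⊆p∪q ⁅ j ⁆) (hereditary (∪-⁅⁆-mono (p⊆p∪q ⁅ j ⁆)) ind′))
      where
      y≢j : y ≢ j
      y≢j refl = y∉Ij (q⊆p∪q (basis p) ⁅ j ⁆ (x∈⁅x⁆ j))

    spanned : ∀ p {j k} → Outside p j → rank (p ⊕ j) ≡ rank p → rank ((p ⊕ k) ⊕ j) ≤ rank (p ⊕ k)
    spanned p {j} {k} oj r≡ with rank ((p ⊕ k) ⊕ j) ≤? rank (p ⊕ k)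
    ... | yes r≤ = r≤
    ... | no  r≰ with extend {basis p} {p ⊕ k} (proj₁ (basis-spec p)) (⊆-trans (proj₂ (basis-spec p)) (⊆⊕ p k))
    ... | J , indJ , I⊆J , J⊆ , J≡r with augment {J} {(p ⊕ k) ⊕ j} indJ (subst (_< rank ((p ⊕ k) ⊕ j)) (sym J≡r) (≰⇒> r≰))
    ... | x , x∈ , x∉J , ind with x Finₚ.≟ j
    ... | no x≢j   = ⊥-elim (no-larger {p = p ⊕ k} J≡r J⊆ (∈⊕⁻ (p ⊕ k) x∈ x≢j) x∉J ind)
    ... | yes refl = ⊥-elim (no-larger {p = p ⊕ j} (sym r≡) (⊆-trans (proj₂ (basis-spec p)) (⊆⊕ p j)) (∈⊕ p j)
            (outside⇒∉ {p = p} oj ∘ proj₂ (basis-spec p)) (hereditary (∪-⁅⁆-mono I⊆J) ind))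

    rank-submodular : ∀ p {j k} → OutsidePair p j k → rank p + rank ((p ⊕ j) ⊕ k) ≤ rank (p ⊕ j) + rank (p ⊕ k)
    rank-submodular p {j} {k} (oj , ok , j≢k) with rank (p ⊕ j) ≟ rank p
    ... | yes r≡ = +-mono-≤ (≤-reflexive (sym r≡))
            (subst (λ q → rank q ≤ rank (p ⊕ k)) (sym (⊕-comm p j≢k)) (spanned p oj r≡))
    ... | no  r≢ = ≤-trans (+-monoʳ-≤ (rank p) (subst (λ q → rank q ≤ suc (rank (p ⊕ k))) (sym (⊕-comm p j≢k))
              (rank-unit (p ⊕ k) (outside-⊕ p j≢k oj))))
            (≤-trans (≤-reflexive (+-suc (rank p) (rank (p ⊕ k))))
              (+-monoˡ-≤ (rank (p ⊕ k)) (≤∧≢⇒< (rank-mono (⊆⊕ p j)) (r≢ ∘ sym))))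

    rank-rankLike : RankLike rank
    rank-rankLike = record
      { monotone   = λ p {j} _ → rank-mono (⊆⊕ p j)
      ; unit       = rank-unit
      ; submodular = rank-submodular
      }

    rank≤card : ∀ p → rank p ≤ card p
    rank≤card p = p⊆q⇒∣p∣≤∣q∣ (proj₂ (basis-spec p))

    independent⇒rank≡card : ∀ {p} → Independent p → rank p ≡ card p
    independent⇒rank≡card {p} ind = ≤-antisym (rank≤card p) (rank-max ind ⊆-refl)

    dependent⇒rank<card : ∀ {p} → ¬ Independent p → rank p < card p
    dependent⇒rank<card {p} dep = ≰⇒> λ c≤r →
      dep (hereditary (⊆∧card≥⇒⊇ (proj₂ (basis-spec p)) c≤r) (proj₁ (basis-spec p)))

  ∁-involutive : ∀ {m} (p : Subset m) → ∁ (∁ p) ≡ p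
  ∁-involutive []      = refl
  ∁-involutive (b ∷ p) = cong₂ _∷_ (Boolₚ.not-involutive b) (∁-involutive p)

  ∁-⊕ : ∀ {m} (q : Subset m) {j} → Outside q j → ∁ q ≡ ∁ (q ⊕ j) ⊕ j
  ∁-⊕ (false ∷ q) {zero}  _ = refl
  ∁-⊕ (b ∷ q)     {suc j} o = cong (not b ∷_) (∁-⊕ q o)

  outside-∁-⊕ : ∀ {m} (q : Subset m) j → Outside (∁ (q ⊕ j)) j
  outside-∁-⊕ (b ∷ q) zero    = refl
  outside-∁-⊕ (b ∷ q) (suc j) = outside-∁-⊕ q j

  -- Up to an additive constant, this is the rank function of the dual matroid.
  corank : ∀ {m} → (Subset m → ℕ) → Subset m → ℕ
  corank r q = r (∁ q) + card q

  corank-rankLike : ∀ {m} {r : Subset m → ℕ} → RankLike r → RankLike (corank r)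
  corank-rankLike {m} {r} rankLike = record
    { monotone   = λ q {j} oj → subst₂ _≤_ (cong (λ c → r c + card q) (sym (∁-⊕ q oj)))
        (trans (sym (+-suc (r (∁ (q ⊕ j))) (card q))) (cong (λ z → r (∁ (q ⊕ j)) + z) (sym (card-⊕ q oj))))
        (+-monoˡ-≤ (card q) (unit (∁ (q ⊕ j)) (outside-∁-⊕ q j)))
    ; unit       = λ q {j} oj → subst (_≤ suc (corank r q))
        (trans (sym (+-suc (r (∁ (q ⊕ j))) (card q))) (cong (λ z → r (∁ (q ⊕ j)) + z) (sym (card-⊕ q oj))))
        (s≤s (+-monoˡ-≤ (card q) (subst (λ c → r (∁ (q ⊕ j)) ≤ r c) (sym (∁-⊕ q oj))
          (monotone (∁ (q ⊕ j)) (outside-∁-⊕ q j)))))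
    ; submodular = submodular′
    }
    where
    open RankLike rankLike
    submodular′ : ∀ q {j k} → OutsidePair q j k → corank r q + corank r ((q ⊕ j) ⊕ k) ≤ corank r (q ⊕ j) + corank r (q ⊕ k)
    submodular′ q {j} {k} (oj , ok , j≢k) = subst₂ _≤_
      (trans (rearrange₁ (r c) (r ((c ⊕ k) ⊕ j)) (card q))
        (cong₂ (λ x y → r x + card q + (r c + y)) (sym ∁q≡) (sym (trans (card-⊕ (q ⊕ j) ok′) (cong suc (card-⊕ q oj))))))
      (trans (rearrange₂ (r (c ⊕ k)) (r (c ⊕ j)) (card q))
        (cong₂ _+_ (cong₂ (λ x y → r x + y) (sym (∁-⊕ (q ⊕ j) ok′)) (sym (card-⊕ q oj)))
                   (cong₂ (λ x y → r x + y) (sym ∁qk≡) (sym (card-⊕ q ok)))))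
      (+-monoˡ-≤ (suc (suc (card q + card q))) (submodular c (outside-∁-⊕ (q ⊕ j) k , oj′ , j≢k ∘ sym)))
      where
      c : Subset m
      c = ∁ ((q ⊕ j) ⊕ k)
      ok′ : Outside (q ⊕ j) k
      ok′ = outside-⊕ q (j≢k ∘ sym) ok
      c≡ : c ≡ ∁ ((q ⊕ k) ⊕ j)
      c≡ = cong ∁ (⊕-comm q j≢k)
      oj′ : Outside c j
      oj′ = subst (λ s → Outside s j) (sym c≡) (outside-∁-⊕ (q ⊕ k) j)
      ∁qk≡ : ∁ (q ⊕ k) ≡ c ⊕ j
      ∁qk≡ = trans (∁-⊕ (q ⊕ k) (outside-⊕ q j≢k oj)) (cong (_⊕ j) (sym c≡))
      ∁q≡ : ∁ q ≡ (c ⊕ k) ⊕ j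
      ∁q≡ = trans (∁-⊕ q oj) (cong (_⊕ j) (∁-⊕ (q ⊕ j) ok′))
      rearrange₁ : ∀ x y d → x + y + suc (suc (d + d)) ≡ y + d + (x + suc (suc d))
      rearrange₁ = solve-∀
      rearrange₂ : ∀ x y d → x + y + suc (suc (d + d)) ≡ x + suc d + (y + suc d)
      rearrange₂ = solve-∀

  -- Counting common independent sets

  sumOver-++ : ∀ {A : Set} (f : A → ℤ) xs ys → sumOver (xs ++ ys) f ≡ sumOver xs f ℤ.+ sumOver ys f
  sumOver-++ f []       ys = sym (ℤₚ.+-identityˡ (sumOver ys f))
  sumOver-++ f (x ∷ xs) ys =
    trans (cong (λ z → f x ℤ.+ z) (sumOver-++ f xs ys)) (sym (ℤₚ.+-assoc (f x) (sumOver xs f) (sumOver ys f)))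

  collapse≡sumOver : ∀ {m} (f : Derivatives m) a b → collapse f a b ≡ sumOver (subsets m) (λ p → f (states p) a b)
  collapse≡sumOver {zero}  f a b = sym (ℤₚ.+-identityʳ (f [] a b))
  collapse≡sumOver {suc m} f a b = begin
    collapse (merge f) a b                              ≡⟨ collapse≡sumOver (merge f) a b ⟩
    sumOver (subsets m) (λ p → fₛ p ℤ.+ fₜ p)            ≡⟨ sumOver-+ fₛ fₜ (subsets m) ⟩
    sumOver (subsets m) fₛ ℤ.+ sumOver (subsets m) fₜ    ≡⟨ ℤₚ.+-comm (sumOver (subsets m) fₛ) (sumOver (subsets m) fₜ) ⟩
    sumOver (subsets m) fₜ ℤ.+ sumOver (subsets m) fₛ    ≡⟨ cong₂ ℤ._+_ (sumOver-map (outside ∷_) f′ (subsets m))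
                                                                        (sumOver-map (inside ∷_) f′ (subsets m)) ⟨
    sumOver (map (outside ∷_) (subsets m)) f′ ℤ.+ sumOver (map (inside ∷_) (subsets m)) f′
      ≡⟨ sumOver-++ f′ (map (outside ∷_) (subsets m)) (map (inside ∷_) (subsets m)) ⟨
    sumOver (subsets (suc m)) f′                         ∎
    where
    open ≡-Reasoning
    f′ : Subset (suc m) → ℤ
    f′ p = f (states p) a b
    fₛ fₜ : Subset m → ℤ
    fₛ p = f′ (inside ∷ p)
    fₜ p = f′ (outside ∷ p)

  sumOver-scaled : ∀ {A : Set} c (f : A → ℤ) (h : A → ℕ) → (∀ x → f x ≡ + (c * h x)) →
    ∀ xs → sumOver xs f ≡ + (c * sum (map h xs))
  sumOver-scaled c f h f≡ []       = cong +_ (sym (*-zeroʳ c))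
  sumOver-scaled c f h f≡ (x ∷ xs) = trans (cong₂ ℤ._+_ (f≡ x) (sumOver-scaled c f h f≡ xs))
    (cong +_ (sym (*-distribˡ-+ c (h x) (sum (map h xs)))))

  module _ {A : Set} {P : Pred A 0ℓ} (P? : Decidable P) (h : A → ℕ) (c N : ℕ)
           (hits : ∀ x → P x → h x ≡ c) (misses : ∀ x → ¬ P x → N * h x ≤ c) where

    count-lower : ∀ xs → length (filter P? xs) * c ≤ sum (map h xs)
    count-lower []       = z≤n
    count-lower (x ∷ xs) with P? x
    ... | yes px = +-mono-≤ (≤-reflexive (sym (hits x px))) (count-lower xs)
    ... | no  _  = ≤-trans (count-lower xs) (m≤n+m _ (h x))

    count-upper : ∀ xs → N * sum (map h xs) ≤ (N * length (filter P? xs) + length xs) * c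
    count-upper []       = subst (_≤ (N * 0 + 0) * c) (sym (*-zeroʳ N)) z≤n
    count-upper (x ∷ xs) with P? x
    ... | yes px = begin
      N * (h x + sum (map h xs))                                       ≡⟨ *-distribˡ-+ N (h x) _ ⟩
      N * h x + N * sum (map h xs)                                     ≤⟨ +-mono-≤ (≤-reflexive (cong (N *_) (hits x px))) (count-upper xs) ⟩
      N * c + (N * length (filter P? xs) + length xs) * c              ≤⟨ m≤n+m _ c ⟩
      c + (N * c + (N * length (filter P? xs) + length xs) * c)        ≡⟨ rearrange N c (length (filter P? xs)) (length xs) ⟩
      (N * suc (length (filter P? xs)) + suc (length xs)) * c          ∎
      where
      open ≤-Reasoning
      rearrange : ∀ N c i l → c + (N * c + (N * i + l) * c) ≡ (N * suc i + suc l) * c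
      rearrange = solve-∀
    ... | no ¬px = begin
      N * (h x + sum (map h xs))                                       ≡⟨ *-distribˡ-+ N (h x) _ ⟩
      N * h x + N * sum (map h xs)                                     ≤⟨ +-mono-≤ (misses x ¬px) (count-upper xs) ⟩
      c + (N * length (filter P? xs) + length xs) * c                  ≡⟨ rearrange N c (length (filter P? xs)) (length xs) ⟩
      (N * length (filter P? xs) + suc (length xs)) * c                ∎
      where
      open ≤-Reasoning
      rearrange : ∀ N c i l → c + (N * i + l) * c ≡ (N * i + suc l) * c
      rearrange = solve-∀

  leading-coefficient : ∀ P J L D → (∀ t → P * (suc t * suc t) ≤ D * ((suc t * J + L) * (suc t * J + L))) → P ≤ D * (J * J)
  leading-coefficient P J L D bound with P ≤? D * (J * J)
  ... | yes P≤ = P≤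
  ... | no  P≰ = ⊥-elim (<⇒≱ (*-monoˡ-< N (n<1+n t)) (+-cancelˡ-≤ (D * (J * J) * (N * N)) _ _ (begin
      D * (J * J) * (N * N) + N * N                              ≡⟨ +-comm _ (N * N) ⟩
      suc (D * (J * J)) * (N * N)                                ≤⟨ *-monoˡ-≤ (N * N) (≰⇒> P≰) ⟩
      P * (N * N)                                                ≤⟨ bound t ⟩
      D * ((N * J + L) * (N * J + L))                            ≤⟨ m≤m+n _ (t * (D * (L * L))) ⟩
      D * ((N * J + L) * (N * J + L)) + t * (D * (L * L))        ≡⟨ rearrange t D J L ⟩
      D * (J * J) * (N * N) + D * ((J + J) * L + L * L) * N      ∎)))
    where
    open ≤-Reasoning
    t N : ℕ
    t = D * ((J + J) * L + L * L)
    N = suc t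
    rearrange : ∀ t D J L → D * ((suc t * J + L) * (suc t * J + L)) + t * (D * (L * L)) ≡
      D * (J * J) * (suc t * suc t) + D * ((J + J) * L + L * L) * suc t
    rearrange = solve-∀

  module _ {n : ℕ} (M₁ M₂ : Matroid n) where

    private
      module M₁ = Matroid M₁
      module M₂ = Matroid M₂
      r₁ r₂ : Subset n → ℕ
      r₁ = Rank.rank M₁
      r₂ = Rank.rank M₂

    term : ℕ → ℕ → Subset n → ℕ
    term N k p with card p ≟ k
    ... | yes _ = N ^ (r₁ p + r₂ p)
    ... | no  _ = 0

    term-hit : ∀ N k p → CommonIndependentOfSize M₁ M₂ k p → term N k p ≡ N ^ (k + k)
    term-hit N k p (ind₁ , ind₂ , size) with card p ≟ k
    ... | yes _ = cong (N ^_) (cong₂ _+_ (trans (Rank.independent⇒rank≡card M₁ ind₁) size)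
                                         (trans (Rank.independent⇒rank≡card M₂ ind₂) size))
    ... | no ≢k = ⊥-elim (≢k size)

    term-miss : ∀ t k p → ¬ CommonIndependentOfSize M₁ M₂ k p → suc t * term (suc t) k p ≤ suc t ^ (k + k)
    term-miss t k p ¬common with card p ≟ k
    ... | no  _    = subst (_≤ suc t ^ (k + k)) (sym (*-zeroʳ (suc t))) z≤n
    ... | yes size with M₁.independent? p
    ... | no dep₁  = ^-monoʳ-≤ (suc t) (+-mono-≤ (subst (r₁ p <_) size (Rank.dependent⇒rank<card M₁ dep₁))
                                                 (subst (r₂ p ≤_) size (Rank.rank≤card M₂ p)))
    ... | yes ind₁ = ^-monoʳ-≤ (suc t) (subst (_≤ k + k) (+-suc (r₁ p) (r₂ p))
        (+-mono-≤ (subst (r₁ p ≤_) size (Rank.rank≤card M₁ p))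
                  (subst (r₂ p <_) size (Rank.dependent⇒rank<card M₂ λ ind₂ → ¬common (ind₁ , ind₂ , size)))))

    total : ℕ → ℕ → ℕ
    total N k = sum (map (term N k) (subsets n))

    module Deformed (t : ℕ) where

      N : ℕ
      N = suc t

      module W₁ = Weights (Rank.rank-rankLike M₁) t
      module W₂ = Weights (corank-rankLike (Rank.rank-rankLike M₂)) t

      Φ Ψ : Subset n → ℤ
      Φ = W₁.weight
      Ψ = W₂.weight

      factor : ℕ → ℕ → ℕ
      factor a b = a ! * b ! * N ^ a

      paired-term : ∀ a b → a + b ≡ n → ∀ p → paired n Φ Ψ (states p) a b ≡ + (factor a b * term N b p)
      paired-term a b a+b≡n p = trans (product-states (level n Φ a) (level n Ψ b) p) by-size
        where
        by-size : level n Φ a p ℤ.* level n Ψ b (∁ p) ≡ + (factor a b * term N b p)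
        by-size with card p ≟ b
        ... | no ≢b = trans (cong (ℤ._* level n Ψ b (∁ p)) (level-≢ Φ p λ e →
                ≢b (+-cancelʳ-≡ a _ _ (trans e (trans (sym a+b≡n) (+-comm a b))))))
              (cong +_ (sym (*-zeroʳ (factor a b))))
        ... | yes size = begin
          level n Φ a p ℤ.* level n Ψ b (∁ p)
            ≡⟨ cong₂ ℤ._*_ (level-≡ Φ p p+a) (level-≡ Ψ (∁ p) ∁p+b) ⟩
          Φ p ℤ.* Ψ (∁ p)
            ≡⟨ cong₂ ℤ._*_ (W₁.weight-at p (trans (+-comm a (card p)) p+a)) (W₂.weight-at (∁ p) (trans (+-comm b (card (∁ p))) ∁p+b)) ⟩
          + (a !) ℤ.* + (N ^ r₁ p) ℤ.* (+ (b !) ℤ.* + (N ^ (r₂ (∁ (∁ p)) + card (∁ p))))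
            ≡⟨ cong₂ ℤ._*_ (ℤₚ.pos-* (a !) (N ^ r₁ p)) (ℤₚ.pos-* (b !) (N ^ (r₂ (∁ (∁ p)) + card (∁ p)))) ⟨
          + (a ! * N ^ r₁ p) ℤ.* + (b ! * N ^ (r₂ (∁ (∁ p)) + card (∁ p)))
            ≡⟨ ℤₚ.pos-* (a ! * N ^ r₁ p) (b ! * N ^ (r₂ (∁ (∁ p)) + card (∁ p))) ⟨
          + (a ! * N ^ r₁ p * (b ! * N ^ (r₂ (∁ (∁ p)) + card (∁ p))))
            ≡⟨ cong (λ e → + (a ! * N ^ r₁ p * (b ! * N ^ e))) (cong₂ (λ q c → r₂ q + c) (∁-involutive p) ∁p≡a) ⟩
          + (a ! * N ^ r₁ p * (b ! * N ^ (r₂ p + a)))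
            ≡⟨ cong (λ e → + (a ! * N ^ r₁ p * (b ! * e))) (^-distribˡ-+-* N (r₂ p) a) ⟩
          + (a ! * N ^ r₁ p * (b ! * (N ^ r₂ p * N ^ a)))
            ≡⟨ cong +_ (rearrange (a !) (b !) (N ^ r₁ p) (N ^ r₂ p) (N ^ a)) ⟩
          + (factor a b * (N ^ r₁ p * N ^ r₂ p))
            ≡⟨ cong (λ e → + (factor a b * e)) (^-distribˡ-+-* N (r₁ p) (r₂ p)) ⟨
          + (factor a b * N ^ (r₁ p + r₂ p)) ∎
          where
          open ≡-Reasoning
          p+a : card p + a ≡ n
          p+a = trans (cong (_+ a) size) (trans (+-comm b a) a+b≡n)
          ∁p≡a : card (∁ p) ≡ a
          ∁p≡a = trans (∣∁p∣≡n∸∣p∣ p) (trans (cong (_∸ card p) (sym p+a)) (m+n∸m≡n (card p) a))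
          ∁p+b : card (∁ p) + b ≡ n
          ∁p+b = trans (cong (_+ b) ∁p≡a) a+b≡n
          rearrange : ∀ x y u v w → x * u * (y * (v * w)) ≡ x * y * w * (u * v)
          rearrange = solve-∀

      collapse-total : ∀ a b → a + b ≡ n → collapse (paired n Φ Ψ) a b ≡ + (factor a b * total N b)
      collapse-total a b a+b≡n = trans (collapse≡sumOver (paired n Φ Ψ) a b)
        (sumOver-scaled (factor a b) (λ p → paired n Φ Ψ (states p) a b) (term N b) (paired-term a b a+b≡n) (subsets n))

      collapse-log-concave : ∀ a b → 2 + (a + b) ≡ n → let F = collapse (paired n Φ Ψ) in
        F (2 + a) b ℤ.* F a (2 + b) ℤ.≤ F (1 + a) (1 + b) ℤ.* F (1 + a) (1 + b)
      collapse-log-concave a b ab with collapse-lorentzian (paired n Φ Ψ) (+-identityʳ n) good a b ab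
        where
        good : Good n 0 (paired n Φ Ψ)
        good = paired-good W₁.weight-log-concave W₂.weight-log-concave
      ... | c , 0<c , functional [] d e , bound = discriminant 0<c
        (subst (0ℤ ℤ.≤_) (sym (collapse-total (2 + a) b ab)) (ℤ.+≤+ z≤n)) λ y q →
          subst₂ ℤ._≤_ (cong (c ℤ.*_) (simplify y q (F (2 + a) b) (F (1 + a) (1 + b)) (F a (2 + b))))
            (cong sq (ℤₚ.+-identityˡ (y ℤ.* d ℤ.+ q ℤ.* e))) (bound [] y q)
        where
        F : ℕ → ℕ → ℤ
        F = collapse (paired n Φ Ψ)
        simplify : ∀ y q p r s →
          0ℤ ℤ.+ ((y ℤ.+ y) ℤ.* 0ℤ ℤ.+ (q ℤ.+ q) ℤ.* 0ℤ) ℤ.+ (y ℤ.* y ℤ.* p ℤ.+ (y ℤ.+ y) ℤ.* q ℤ.* r ℤ.+ q ℤ.* q ℤ.* s) ≡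
          y ℤ.* y ℤ.* p ℤ.+ (y ℤ.+ y) ℤ.* q ℤ.* r ℤ.+ q ℤ.* q ℤ.* s
        simplify = ℤ-Solver.solve-∀

      total-log-concave : ∀ a b → 2 + (a + b) ≡ n →
        (2 + a) ! * b ! * (a ! * (2 + b) !) * (total N b * total N (2 + b)) ≤
        (1 + a) ! * (1 + b) ! * ((1 + a) ! * (1 + b) !) * (total N (1 + b) * total N (1 + b))
      total-log-concave a b ab = *-cancelˡ-≤ (N * N ^ a * (N * N ^ a)) {{m*n≢0 (N * N ^ a) (N * N ^ a) {{NNᵃ≢0}} {{NNᵃ≢0}}}}
        (subst₂ _≤_
          (rearrange₁ ((2 + a) !) (b !) (a !) ((2 + b) !) N (N ^ a) (total N b) (total N (2 + b)))
          (rearrange₂ ((1 + a) !) ((1 + b) !) N (N ^ a) (total N (1 + b)))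
          (ℤₚ.drop‿+≤+ (subst₂ ℤ._≤_
            (trans (cong₂ ℤ._*_ (collapse-total (2 + a) b ab) (collapse-total a (2 + b) (trans (shift a 2 b) ab)))
                   (sym (ℤₚ.pos-* (factor (2 + a) b * total N b) _)))
            (trans (cong (λ z → z ℤ.* z) (collapse-total (1 + a) (1 + b) (trans (cong suc (shift a 1 b)) ab)))
                   (sym (ℤₚ.pos-* (factor (1 + a) (1 + b) * total N (1 + b)) _)))
            (collapse-log-concave a b ab))))
        where
        NNᵃ≢0 : NonZero (N * N ^ a)
        NNᵃ≢0 = m*n≢0 N (N ^ a) {{_}} {{m^n≢0 N a}}
        shift : ∀ a c b → a + (c + b) ≡ c + (a + b)
        shift = solve-∀
        rearrange₁ : ∀ f₁ f₂ f₃ f₄ N X T T′ →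
          f₁ * f₂ * (N * (N * X)) * T * (f₃ * f₄ * X * T′) ≡ N * X * (N * X) * (f₁ * f₂ * (f₃ * f₄) * (T * T′))
        rearrange₁ = solve-∀
        rearrange₂ : ∀ f g N X T → f * g * (N * X) * T * (f * g * (N * X) * T) ≡ N * X * (N * X) * (f * g * (f * g) * (T * T))
        rearrange₂ = solve-∀

    private
      I : ℕ → ℕ
      I = #commonIndependent M₁ M₂

    count-log-concave : ∀ a k → 2 + (a + k) ≡ n →
      (2 + a) ! * k ! * (a ! * (2 + k) !) * (I k * I (2 + k)) ≤
      (1 + a) ! * (1 + k) ! * ((1 + a) ! * (1 + k) !) * (I (1 + k) * I (1 + k))
    count-log-concave a k ak = leading-coefficient (D * (I k * I (2 + k))) (I (1 + k)) L D′ λ t →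
      let N = suc t
          c = N ^ (1 + k + (1 + k))
          T = total N
          instance
            c≢0 : NonZero c
            c≢0 = m^n≢0 N (1 + k + (1 + k))
          lower = λ j → count-lower (commonIndependentOfSize? M₁ M₂ j) (term N j) (N ^ (j + j)) N
                          (term-hit N j) (term-miss t j) (subsets n)
          upper = λ j → count-upper (commonIndependentOfSize? M₁ M₂ j) (term N j) (N ^ (j + j)) N
                          (term-hit N j) (term-miss t j) (subsets n)
      in *-cancelʳ-≤ _ _ (c * c) {{m*n≢0 c c}} (begin
        D * (I k * I (2 + k)) * (N * N) * (c * c)
          ≡⟨ cong (D * (I k * I (2 + k)) * (N * N) *_) (powers N) ⟨
        D * (I k * I (2 + k)) * (N * N) * (N ^ (k + k) * N ^ (2 + k + (2 + k)))
          ≡⟨ rearrange₁ D (I k) (I (2 + k)) N (N ^ (k + k)) (N ^ (2 + k + (2 + k))) ⟩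
        N * N * (D * (I k * N ^ (k + k) * (I (2 + k) * N ^ (2 + k + (2 + k)))))
          ≤⟨ *-monoʳ-≤ (N * N) (*-monoʳ-≤ D (*-mono-≤ (lower k) (lower (2 + k)))) ⟩
        N * N * (D * (T k * T (2 + k)))
          ≤⟨ *-monoʳ-≤ (N * N) (Deformed.total-log-concave t a k ak) ⟩
        N * N * (D′ * (T (1 + k) * T (1 + k)))
          ≡⟨ rearrange₂ N D′ (T (1 + k)) ⟩
        D′ * (N * T (1 + k) * (N * T (1 + k)))
          ≤⟨ *-monoʳ-≤ D′ (*-mono-≤ (upper (1 + k)) (upper (1 + k))) ⟩
        D′ * ((N * I (1 + k) + L) * c * ((N * I (1 + k) + L) * c))
          ≡⟨ rearrange₃ D′ (N * I (1 + k) + L) c ⟩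
        D′ * ((N * I (1 + k) + L) * (N * I (1 + k) + L)) * (c * c) ∎)
      where
      open ≤-Reasoning
      D D′ L : ℕ
      D = (2 + a) ! * k ! * (a ! * (2 + k) !)
      D′ = (1 + a) ! * (1 + k) ! * ((1 + a) ! * (1 + k) !)
      L = length (subsets n)
      powers : ∀ N → N ^ (k + k) * N ^ (2 + k + (2 + k)) ≡ N ^ (1 + k + (1 + k)) * N ^ (1 + k + (1 + k))
      powers N = trans (sym (^-distribˡ-+-* N (k + k) (2 + k + (2 + k))))
        (trans (cong (N ^_) (exponents k)) (^-distribˡ-+-* N (1 + k + (1 + k)) (1 + k + (1 + k))))
        where
        exponents : ∀ k → k + k + (2 + k + (2 + k)) ≡ 1 + k + (1 + k) + (1 + k + (1 + k))
        exponents = solve-∀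
      rearrange₁ : ∀ D i j N x y → D * (i * j) * (N * N) * (x * y) ≡ N * N * (D * (i * x * (j * y)))
      rearrange₁ = solve-∀
      rearrange₂ : ∀ N D T → N * N * (D * (T * T)) ≡ D * (N * T * (N * T))
      rearrange₂ = solve-∀
      rearrange₃ : ∀ D x c → D * (x * c * (x * c)) ≡ D * (x * x) * (c * c)
      rearrange₃ = solve-∀

    binomial-log-concave : ∀ k → 2 + k ≤ n →
      I k * I (2 + k) * ((n C (1 + k)) * (n C (1 + k))) ≤ I (1 + k) * I (1 + k) * ((n C k) * (n C (2 + k)))
    binomial-log-concave k 2+k≤n = *-cancelʳ-≤ _ _ (D * D′) {{m*n≢0 D D′ {{D≢0}} {{D′≢0}}}} (begin
      I k * I (2 + k) * ((n C (1 + k)) * (n C (1 + k))) * (D * D′)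
        ≡⟨ rearrange₁ (I k * I (2 + k)) ((n C (1 + k))) D ((1 + k) !) ((1 + a) !) ⟩
      D * (I k * I (2 + k)) * ((n C (1 + k)) * ((1 + k) ! * (1 + a) !) * ((n C (1 + k)) * ((1 + k) ! * (1 + a) !)))
        ≡⟨ cong (λ z → D * (I k * I (2 + k)) * (z * z)) (binomial (1 + a) (1 + k) (trans (cong suc (+-suc a k)) ak)) ⟩
      D * (I k * I (2 + k)) * (n ! * n !)
        ≤⟨ *-monoˡ-≤ (n ! * n !) (count-log-concave a k ak) ⟩
      D′ * (I (1 + k) * I (1 + k)) * (n ! * n !)
        ≡⟨ cong₂ (λ x y → D′ * (I (1 + k) * I (1 + k)) * (x * y)) (binomial (2 + a) k ak)
             (binomial a (2 + k) (trans (+-suc a (suc k)) (trans (cong suc (+-suc a k)) ak))) ⟨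
      D′ * (I (1 + k) * I (1 + k)) * ((n C k) * (k ! * (2 + a) !) * ((n C (2 + k)) * ((2 + k) ! * a !)))
        ≡⟨ rearrange₂ D′ (I (1 + k) * I (1 + k)) ((n C k)) ((n C (2 + k))) (k !) ((2 + a) !) ((2 + k) !) (a !) ⟩
      I (1 + k) * I (1 + k) * ((n C k) * (n C (2 + k))) * (D * D′) ∎)
      where
      open ≤-Reasoning
      a D D′ : ℕ
      a = n ∸ (2 + k)
      D = (2 + a) ! * k ! * (a ! * (2 + k) !)
      D′ = (1 + a) ! * (1 + k) ! * ((1 + a) ! * (1 + k) !)
      ak : 2 + (a + k) ≡ n
      ak = trans (sym (trans (+-suc a (suc k)) (cong suc (+-suc a k)))) (m∸n+n≡m 2+k≤n)
      D≢0 : NonZero D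
      D≢0 = m*n≢0 ((2 + a) ! * k !) (a ! * (2 + k) !) {{(2 + a) !* k !≢0}} {{a !* (2 + k) !≢0}}
      D′≢0 : NonZero D′
      D′≢0 = m*n≢0 ((1 + a) ! * (1 + k) !) ((1 + a) ! * (1 + k) !) {{(1 + a) !* (1 + k) !≢0}} {{(1 + a) !* (1 + k) !≢0}}
      binomial : ∀ b j → b + j ≡ n → (n C j) * (j ! * b !) ≡ n !
      binomial b j refl = trans (cong (λ c → ((b + j) C j) * (j ! * c !)) (sym (m+n∸n≡m b j)))
        (trans (cong (_* (j ! * (b + j ∸ j) !)) (nCk≡n!/k![n-k]! j≤)) (m/n*n≡m (k![n∸k]!∣n! j≤)))
        where
        j≤ : j ≤ b + j
        j≤ = m≤n+m j b
        instance
          _ = j !* (b + j ∸ j) !≢0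
      rearrange₁ : ∀ i c D f g → i * (c * c) * (D * (g * f * (g * f))) ≡ D * i * (c * (f * g) * (c * (f * g)))
      rearrange₁ = solve-∀
      rearrange₂ : ∀ D i c d f g h l → D * i * (c * (f * g) * (d * (h * l))) ≡ i * (c * d) * (g * f * (l * h) * D)
      rearrange₂ = solve-∀

  fraction-*-≤ : ∀ {a b c d p q r s} .{{_ : NonZero p}} .{{_ : NonZero q}} .{{_ : NonZero r}} .{{_ : NonZero s}} →
    a * b * (r * s) ≤ c * d * (p * q) →
    (+ a ℚ./ p) ℚ.* (+ b ℚ./ q) ℚ.≤ (+ c ℚ./ r) ℚ.* (+ d ℚ./ s)
  fraction-*-≤ {a} {b} {c} {d} {suc p} {suc q} {suc r} {suc s} ineq = ℚₚ.toℚᵘ-cancel-≤ (begin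
    ℚ.toℚᵘ ((+ a ℚ./ suc p) ℚ.* (+ b ℚ./ suc q))         ≃⟨ unnormalise a p b q ⟩
    mkℚᵘ (+ a) p ℚᵘ.* mkℚᵘ (+ b) q                       ≤⟨ *≤* (subst₂ ℤ._≤_ (cast a b (suc r) (suc s)) (cast c d (suc p) (suc q)) (ℤ.+≤+ ineq)) ⟩
    mkℚᵘ (+ c) r ℚᵘ.* mkℚᵘ (+ d) s                       ≃⟨ unnormalise c r d s ⟨
    ℚ.toℚᵘ ((+ c ℚ./ suc r) ℚ.* (+ d ℚ./ suc s))         ∎)
    where
    open ℚᵘₚ.≤-Reasoning
    unnormalise : ∀ a p b q → ℚ.toℚᵘ ((+ a ℚ./ suc p) ℚ.* (+ b ℚ./ suc q)) ℚᵘ.≃ mkℚᵘ (+ a) p ℚᵘ.* mkℚᵘ (+ b) q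
    unnormalise a p b q = ℚᵘₚ.≃-trans (ℚₚ.toℚᵘ-homo-* (+ a ℚ./ suc p) (+ b ℚ./ suc q))
      (ℚᵘₚ.*-cong (ℚₚ.toℚᵘ-fromℚᵘ (mkℚᵘ (+ a) p)) (ℚₚ.toℚᵘ-fromℚᵘ (mkℚᵘ (+ b) q)))
    cast : ∀ a b r s → + (a * b * (r * s)) ≡ + a ℤ.* + b ℤ.* + (r * s)
    cast a b r s = trans (ℤₚ.pos-* (a * b) (r * s)) (cong (ℤ._* + (r * s)) (ℤₚ.pos-* a b))

open import Data.Nat.Base using (ℕ; _+_; _≤_)
open import Data.Nat.Combinatorics using (_C_)
open import Data.Nat.Properties using (m+n≤o⇒n≤o; <⇒≤)
open import Data.Rational.Base using (_*_) renaming (_≤_ to _≤ℚ_)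
open CommonIndependentSets using (fraction-*-≤; binomial-log-concave)

corollary1 : ∀ (n : ℕ) (M₁ M₂ : Matroid n) (k : ℕ) (2+k≤n : 2 + k ≤ n) →
    normalisedCount M₁ M₂ k (m+n≤o⇒n≤o 2 2+k≤n) * normalisedCount M₁ M₂ (2 + k) 2+k≤n
    ≤ℚ normalisedCount M₁ M₂ (1 + k) (<⇒≤ 2+k≤n) * normalisedCount M₁ M₂ (1 + k) (<⇒≤ 2+k≤n)
corollary1 n M₁ M₂ k 2+k≤n = fraction-*-≤
  {#commonIndependent M₁ M₂ k} {#commonIndependent M₁ M₂ (2 + k)}
  {#commonIndependent M₁ M₂ (1 + k)} {#commonIndependent M₁ M₂ (1 + k)}
  {n C k} {n C (2 + k)} {n C (1 + k)} {n C (1 + k)}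
  {{nCk≢0 (m+n≤o⇒n≤o 2 2+k≤n)}} {{nCk≢0 2+k≤n}} {{nCk≢0 (<⇒≤ 2+k≤n)}} {{nCk≢0 (<⇒≤ 2+k≤n)}}
  (binomial-log-concave M₁ M₂ k 2+k≤n)
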